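{- Let $p\ge 1$, $k\ge 2$, $k>p$ be integers, and let $H_m=\sum_{i=1}^m \frac1i$. Consider the linear program $(P)$ in the variables $a_{i,j}$: $$\max\ \frac1k\sum_{j=1}^k j\,a_{k,j}+\sum_{i=p+1}^{k-1}\Big(\frac{1}{i(i+1)}\sum_{j=1}^i j\,a_{i,j}\Big)+\frac{1}{p+1}a_{p,p}$$ subject to $$\sum_{j=1}^i a_{i,j}\le 1\quad (i=p+1,\dots,k),\qquad a_{p,p}\le 1,$$ $$\sum_{j=1}^{i-1} j\,a_{i-1,j}-\sum_{j=1}^{i-1} j\,a_{i,j}-(i-2)a_{i,i}\le 0\quad (i=p+1,\dots,k),$$ $$a_{i,j}\ge 0\quad (i=p,\dots,k,\ j=1,\dots,i).$$ (1) The solution of $(P)$ is given as follows. If $k-p$ is even: $a_{p+2j+1,\,p+2j}=a_{p+2j,\,p+2j}=1$ for all $j=0,\dots,\frac{k-p-2}{2}$, $a_{k,k}=1$, and all other $a_{i,j}$ are zero. If $k-p$ is odd: $a_{p+2j+1,\,p+2j}=a_{p+2j,\,p+2j}=1$ for all $j=0,\dots,\frac{k-p-3}{2}$, $a_{k,k}=a_{k-1,k-2}=1$, and all other $a_{i,j}$ are zero. (2) The optimal objective function value $\rho$ of $(P)$ is $$\rho=\begin{cases} H_{k/2}-H_{p/2}+1 & p \text{ even},\ k\text{ even},\\ H_{(k-1)/2}-H_{p/2}+1+\frac1k-\frac1{k(k-1)} & p\text{ even},\ k\text{ odd},\\ 2(H_k-H_{p+1})-H_{k/2}+H_{(p+1)/2}+1+\frac1k-\frac1{k(k-1)}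 & p\text{ odd},\ k\text{ even},\\ 2(H_{k+1}-H_{p+1})-H_{(k+1)/2}+H_{(p+1)/2}+1 & p\text{ odd},\ k\text{ odd}.\end{cases}$$ (3) For every $\epsilon>0$, Algorithm $A1$ (with its packing accuracy parameter chosen sufficiently small) is an asymptotic $(\rho+\epsilon)$-approximation algorithm for $(p,k)$-uniform unweighted set cover.
   Context: $(p,k)$-uniform unweighted set cover ($(p,k)$-UUSC): given $n$ base elements and a finite collection of subsets of them, each of size between $p$ and $k$, such that all subsets of size $p$ belong to the collection, find a subcollection of minimum cardinality covering all base elements. The collection is treated as subset-closed (every subset of an available set is also available), so covers may be taken to consist of pairwise disjoint sets. $|OPT|$ is the minimum cardinality of a cover. Algorithm $A1$, with accuracy parameter $\epsilon'>0$: during the execution an $i$-set is an available subset of size $i$ all of whose elements are still uncovered. For $i=k$ down to $p+1$ (packing phases): find a maximal (with respect to inclusion) collection of pairwise disjoint $i$-sets using a polynomial-time $\frac{2-\epsilon'}{i}$-approximation algorithm for maximizing the number of disjoint $i$-sets (i.e. the collection found has at least $\frac{2-\epsilon'}{i}$ times the maximum possible number of disjoint $i$-sets; such an algorithm is due to Hurkens and Schrijver), and add it to the cover. Phase $p$: cover the remaining base elements by disjoint $p$-sets, and possibly one additional set of size less than $p$ covering the leftover elements. An algorithm is an asymptotic $r$-approximation algorithm if the limit superior, as $|OPT|\to\infty$, of the worst-case ratio between the size of the cover it returns and $|OPT|$ is at most $r$.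
   Formalization: The LP variables and the tolerances are rational instead of real; in (1), for k=p+1 with p≥2, where the listed solution is not optimal (p=2, k=3: value 1 < 7/6), the optimal solution is instead a_{k,k}=1, a_{p,p}=(p-1)/p, all others zero. In (1), for k=p+1 with p≥2 the listed solution is not optimal (p=2, k=3: value 1, optimum 7/6), so there the optimal solution a_{k,k}=1, a_{p,p}=(p-1)/p, others 0, is stated instead; the variables a_{i,j}, epsilon and the accuracy parameter are rational, which is equivalent. -}

module Defs where

open import Data.Bool.Base using (if_then_else_)
open import Data.Fin.Subset using (Subset; _⊆_; _∩_; _─_; ⋃; ⊤; ∣_∣; Nonempty; Empty)
open import Data.Integer.Base using (+_)
open import Data.List.Base using (List; []; _∷_; _++_; map; foldr; length; upTo; concatMap)
open import Data.List.Membership.DecPropositional using () renaming (_∈?_ to mem?)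
open import Data.List.Membership.Propositional using (_∈_)
open import Data.List.Relation.Binary.Subset.Propositional using () renaming (_⊆_ to _⊆ˡ_)
open import Data.List.Relation.Unary.All using (All)
open import Data.List.Relation.Unary.AllPairs using (AllPairs)
open import Data.Nat as ℕ using (ℕ; zero; suc; _∸_; ⌊_/2⌋; parity)
open import Data.Parity.Base using (Parity; 0ℙ; 1ℙ)
open import Data.Product.Base using (_×_; _,_; ∃-syntax)
open import Data.Product.Properties using (≡-dec)
open import Data.Rational.Base using (ℚ; 0ℚ; 1ℚ; _/_; _+_; _*_; _-_; _≤_; _<_)
open import Relation.Binary.PropositionalEquality.Core using (_≡_)
open import Relation.Nullary.Decidable.Core using (does)

------------------------------------------------------------------------
-- Rational arithmetic

ℕ→ℚ : ℕ → ℚ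
ℕ→ℚ n = + n / 1

-- The value at 0 is junk; only positive arguments occur below.
1/ℕ : ℕ → ℚ
1/ℕ zero    = 0ℚ
1/ℕ (suc n) = + 1 / suc n

-- ∑ m n f = f m + f (m + 1) + … + f n, which is 0 when n < m.
∑ : ℕ → ℕ → (ℕ → ℚ) → ℚ
∑ m n f = foldr _+_ 0ℚ (map (λ i → f (m ℕ.+ i)) (upTo (suc n ∸ m)))

H : ℕ → ℚ
H m = ∑ 1 m 1/ℕ

------------------------------------------------------------------------
-- The linear program (P)

-- The variables are the a i j with p ≤ i ≤ k and 1 ≤ j ≤ i.  No other
-- entry of a occurs in the objective or in the constraints.
Matrix : Set
Matrix = ℕ → ℕ → ℚ

objective : (p k : ℕ) → Matrix → ℚ
objective p k a =
    1/ℕ k * ∑ 1 k (λ j → ℕ→ℚ j * a k j)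
  + ∑ (p ℕ.+ 1) (k ∸ 1)
      (λ i → 1/ℕ (i ℕ.* (i ℕ.+ 1)) * ∑ 1 i (λ j → ℕ→ℚ j * a i j))
  + 1/ℕ (p ℕ.+ 1) * a p p

record Feasible (p k : ℕ) (a : Matrix) : Set where
  field
    row-sum : ∀ i → p ℕ.+ 1 ℕ.≤ i → i ℕ.≤ k → ∑ 1 i (λ j → a i j) ≤ 1ℚ
    base    : a p p ≤ 1ℚ
    flow    : ∀ i → p ℕ.+ 1 ℕ.≤ i → i ℕ.≤ k →
              ∑ 1 (i ∸ 1) (λ j → ℕ→ℚ j * a (i ∸ 1) j)
              - ∑ 1 (i ∸ 1) (λ j → ℕ→ℚ j * a i j)
              - ℕ→ℚ (i ∸ 2) * a i i ≤ 0ℚ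
    nonneg  : ∀ i j → p ℕ.≤ i → i ℕ.≤ k → 1 ℕ.≤ j → j ℕ.≤ i → 0ℚ ≤ a i j

IsOptimalSolution : (p k : ℕ) → Matrix → Set
IsOptimalSolution p k a =
  Feasible p k a × (∀ b → Feasible p k b → objective p k b ≤ objective p k a)

IsOptimalValue : (p k : ℕ) → ℚ → Set
IsOptimalValue p k v =
  (∃[ a ] Feasible p k a × objective p k a ≡ v) ×
  (∀ b → Feasible p k b → objective p k b ≤ v)

lastOnes : Parity → ℕ → List (ℕ × ℕ)
lastOnes 0ℙ k = (k , k) ∷ []
lastOnes 1ℙ k = (k , k) ∷ (k ∸ 1 , k ∸ 2) ∷ []

-- The positions of the ones in the closed-form solution.  With
-- q = ⌊ (k - p) / 2 ⌋ the index j below runs over 0, …, q - 1, and q - 1 is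
-- (k - p - 2) / 2 for k - p even and (k - p - 3) / 2 for k - p odd.
ones : (p k : ℕ) → List (ℕ × ℕ)
ones p k =
  concatMap (λ j → (p ℕ.+ 2 ℕ.* j ℕ.+ 1 , p ℕ.+ 2 ℕ.* j)
                 ∷ (p ℕ.+ 2 ℕ.* j       , p ℕ.+ 2 ℕ.* j)
                 ∷ [])
            (upTo ⌊ k ∸ p /2⌋)
  ++ lastOnes (parity (k ∸ p)) k

closedForm : (p k : ℕ) → Matrix
closedForm p k i j =
  if does (mem? (≡-dec ℕ._≟_ ℕ._≟_) (i , j) (ones p k)) then 1ℚ else 0ℚ

-- For k = p + 1 the position (k - 1 , k - 2) of closedForm is (p , p - 1).
-- Its entry has weight 0 in the objective, because row p contributes only
-- through a p p, so closedForm has value 1 and for p ≥ 2 is not optimal.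
-- The same p - 1 units in row p have to be carried by a p p instead:
-- a p p = (p - 1) / p.
narrowForm : (p : ℕ) → Matrix
narrowForm p i j =
  if does (mem? (≡-dec ℕ._≟_ ℕ._≟_) (i , j) ((p ℕ.+ 1 , p ℕ.+ 1) ∷ []))
  then 1ℚ
  else if does (mem? (≡-dec ℕ._≟_ ℕ._≟_) (i , j) ((p , p) ∷ []))
  then ℕ→ℚ (p ∸ 1) * 1/ℕ p
  else 0ℚ

-- Every halving below is exact for the parities at hand.
ρ-cases : Parity → Parity → (p k : ℕ) → ℚ
ρ-cases 0ℙ 0ℙ p k = H ⌊ k /2⌋ - H ⌊ p /2⌋ + 1ℚ
ρ-cases 0ℙ 1ℙ p k =
  H ⌊ k ∸ 1 /2⌋ - H ⌊ p /2⌋ + 1ℚ + 1/ℕ k - 1/ℕ (k ℕ.* (k ∸ 1))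
ρ-cases 1ℙ 0ℙ p k =
  ℕ→ℚ 2 * (H k - H (p ℕ.+ 1)) - H ⌊ k /2⌋ + H ⌊ p ℕ.+ 1 /2⌋ + 1ℚ
  + 1/ℕ k - 1/ℕ (k ℕ.* (k ∸ 1))
ρ-cases 1ℙ 1ℙ p k =
  ℕ→ℚ 2 * (H (k ℕ.+ 1) - H (p ℕ.+ 1)) - H ⌊ k ℕ.+ 1 /2⌋ + H ⌊ p ℕ.+ 1 /2⌋ + 1ℚ

ρ : (p k : ℕ) → ℚ
ρ p k = ρ-cases (parity p) (parity k) p k

------------------------------------------------------------------------
-- (p,k)-uniform unweighted set cover

record Instance (p k : ℕ) : Set where
  field
    size       : ℕ
    collection : List (Subset size)
    sizes      : ∀ {S} → S ∈ collection → p ℕ.≤ ∣ S ∣ × ∣ S ∣ ℕ.≤ k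
    uniform    : ∀ S → ∣ S ∣ ≡ p → S ∈ collection

module _ {p k : ℕ} (I : Instance p k) where
  open Instance I

  -- The subset-closure of the collection.
  Available : Subset size → Set
  Available S = ∃[ T ] T ∈ collection × S ⊆ T

  IsCover : List (Subset size) → Set
  IsCover C = All Available C × ⋃ C ≡ ⊤

  IsOPT : ℕ → Set
  IsOPT m = (∃[ C ] IsCover C × length C ≡ m) ×
            (∀ C → IsCover C → m ℕ.≤ length C)

Disjoint : ∀ {n} → Subset n → Subset n → Set
Disjoint S T = Empty (S ∩ T)

------------------------------------------------------------------------
-- Algorithm A1

-- U is the set of base elements that are still uncovered.
module _ {p k : ℕ} (I : Instance p k) where
  open Instance I

  IsSetOfSize : (i : ℕ) (U S : Subset size) → Set
  IsSetOfSize i U S = Available I S × ∣ S ∣ ≡ i × S ⊆ U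

  Packing : (i : ℕ) (U : Subset size) → List (Subset size) → Set
  Packing i U C = All (IsSetOfSize i U) C × AllPairs Disjoint C

  Maximal : (i : ℕ) (U : Subset size) → List (Subset size) → Set
  Maximal i U C = ∀ D → Packing i U D → C ⊆ˡ D → D ⊆ˡ C

  -- |C| ≥ (2 - ε′) / i times the maximum number of disjoint i-sets.
  Accurate : (ε′ : ℚ) (i : ℕ) (U : Subset size) → List (Subset size) → Set
  Accurate ε′ i U C = ∀ D → Packing i U D →
    (ℕ→ℚ 2 - ε′) * 1/ℕ i * ℕ→ℚ (length D) ≤ ℕ→ℚ (length C)

  -- Run ε′ i U C: executing phases i, i - 1, …, p with U uncovered may add
  -- exactly the sets C to the cover.  The packing subroutine is any one with
  -- the stated guarantee, so A1 is a relation rather than a function.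
  data Run (ε′ : ℚ) : ℕ → Subset size → List (Subset size) → Set where
    pack     : ∀ {i U C D} → p ℕ.< i →
               Packing i U C → Maximal i U C → Accurate ε′ i U C →
               Run ε′ (i ∸ 1) (U ─ ⋃ C) D →
               Run ε′ i U (C ++ D)
    exact    : ∀ {U C} → Packing p U C → Empty (U ─ ⋃ C) →
               Run ε′ p U C
    leftover : ∀ {U C} → Packing p U C → Nonempty (U ─ ⋃ C) →
               ∣ U ─ ⋃ C ∣ ℕ.< p → Available I (U ─ ⋃ C) →
               Run ε′ p U (C ++ (U ─ ⋃ C) ∷ [])

-- An algorithm, given by its possible outputs on each instance.
Algorithm : (p k : ℕ) → Set₁
Algorithm p k = (I : Instance p k) → List (Subset (Instance.size I)) → Set

A1 : (p k : ℕ) (ε′ : ℚ) → Algorithm p k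
A1 p k ε′ I C = Run I ε′ k ⊤ C

-- The limit superior, as |OPT| → ∞, of the worst-case ratio is at most r:
-- for every δ > 0 all ratios |C| / |OPT| with |OPT| large are at most r + δ.
record IsAsymptoticApproximation {p k : ℕ} (A : Algorithm p k) (r : ℚ) : Set where
  field
    covers  : ∀ I C → A I C → IsCover I C
    limsup≤ : ∀ δ → 0ℚ < δ → ∃[ N ] (∀ I C m → A I C → IsOPT I m →
              N ℕ.≤ m → ℕ→ℚ (length C) ≤ (r + δ) * ℕ→ℚ m)

{-# OPTIONS --safe #-}
-- Let s i be the number of elements still uncovered when phase i starts and M
-- the size of an optimal cover; in the linear program s i is the total
-- Σ j a_{i,j} of row i and M = 1.  In both settings s i ≤ i M and
-- s (i + 1) + s i ≤ 2 i M (up to an ε′ M in the algorithm): if x optimal sets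
-- still have i + 1 uncovered elements (x = a_{i+1,i+1} in the program), then
-- s (i + 1) ≤ i M + x and, since the packing covers at least about 2 x of these
-- elements, s i ≤ i M - x.  The cost, equal to the objective, is s p / p + Σ (s (i + 1) - s i) / (i + 1).  Its weight on s i is
-- w i = 1 / i - 1 / (i + 1), decreasing in i, so grouping the levels into pairs
-- (p , p + 1), (p + 2 , p + 3), … and writing
--   w i s i + w (i + 1) s (i + 1)
--     = w (i + 1) (s i + s (i + 1)) + (w i - w (i + 1)) s i
-- bounds each pair by 2 M / (i + 2).  The sum of these bounds is ρ, and the
-- closed form attains every one of them.
module Submission where

open import Defs
open import Data.Bool.Base using (true; false; if_then_else_)
open import Data.Empty using (⊥-elim)
open import Data.Fin.Subset using (Subset; _⊆_; _∩_; _─_; ⋃; ⊤; ⊥; ∣_∣; Nonempty; inside; outside)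
  renaming (_∈_ to _∈ₛ_; _∉_ to _∉ₛ_)
open import Data.Fin.Subset.Properties
open import Data.Integer.Base as ℤ using (-[1+_])
import Data.Integer.Properties as ℤP
open import Data.List.Base using (List; []; _∷_; _++_; map; foldr; length; upTo; concatMap)
open import Data.List.Membership.DecPropositional using () renaming (_∈?_ to mem?)
open import Data.List.Membership.Propositional using (_∈_; find; lose)
open import Data.List.Membership.Propositional.Properties
  using (∈-concatMap⁺; ∈-concatMap⁻; ∈-upTo⁺; ∈-upTo⁻; ∈-++⁺ˡ; ∈-++⁺ʳ; ∈-++⁻)
open import Data.List.Properties using (upTo-∷ʳ; map-++; foldr-++; length-++)
open import Data.List.Relation.Unary.All as All using (All; []; _∷_)
import Data.List.Relation.Unary.All.Properties as AllP
open import Data.List.Relation.Unary.AllPairs using ([]; _∷_)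
open import Data.List.Relation.Unary.Any using (here; there)
open import Data.Nat as ℕ using (ℕ; zero; suc; z≤n; s≤s; _∸_; ⌊_/2⌋; parity)
import Data.Nat.Properties as ℕP
open import Data.Parity.Base using (0ℙ; 1ℙ)
open import Data.Product.Base using (_×_; _,_; ∃-syntax; proj₁; proj₂)
open import Data.Product.Properties using (≡-dec)
open import Data.Rational.Base hiding (NonZero; nonZero; ∣_∣)
open import Data.Rational.Properties hiding (_≟_)
open import Data.Rational.Solver using (module +-*-Solver)
open import Data.Rational.Unnormalised.Base as ℚᵘ using (mkℚᵘ)
import Data.Rational.Unnormalised.Properties as ℚᵘP
open import Data.Sum.Base using (_⊎_; inj₁; inj₂)
open import Data.Vec.Base using ([]; _∷_; here; there)
open import Relation.Binary.PropositionalEquality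
open import Relation.Nullary using (¬_; Dec; yes; no; does)
open import Relation.Nullary.Decidable using (dec-true; dec-false)
open +-*-Solver using (solve; _:+_; _:*_; _:-_; _:=_; con)

-- Rational arithmetic

fromℚᵘ-homo-+ : ∀ x y → fromℚᵘ (x ℚᵘ.+ y) ≡ fromℚᵘ x + fromℚᵘ y
fromℚᵘ-homo-+ x y = toℚᵘ-injective
  (ℚᵘP.≃-trans (toℚᵘ-fromℚᵘ (x ℚᵘ.+ y))
  (ℚᵘP.≃-sym (ℚᵘP.≃-trans (toℚᵘ-homo-+ (fromℚᵘ x) (fromℚᵘ y))
    (ℚᵘP.+-cong (toℚᵘ-fromℚᵘ x) (toℚᵘ-fromℚᵘ y)))))

fromℚᵘ-homo-* : ∀ x y → fromℚᵘ (x ℚᵘ.* y) ≡ fromℚᵘ x * fromℚᵘ y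
fromℚᵘ-homo-* x y = toℚᵘ-injective
  (ℚᵘP.≃-trans (toℚᵘ-fromℚᵘ (x ℚᵘ.* y))
  (ℚᵘP.≃-sym (ℚᵘP.≃-trans (toℚᵘ-homo-* (fromℚᵘ x) (fromℚᵘ y))
    (ℚᵘP.*-cong (toℚᵘ-fromℚᵘ x) (toℚᵘ-fromℚᵘ y)))))

ℕ→ℚ-+ : ∀ m n → ℕ→ℚ (m ℕ.+ n) ≡ ℕ→ℚ m + ℕ→ℚ n
ℕ→ℚ-+ m n = trans
  (fromℚᵘ-cong {mkℚᵘ (ℤ.+ (m ℕ.+ n)) 0} {mkℚᵘ (ℤ.+ m) 0 ℚᵘ.+ mkℚᵘ (ℤ.+ n) 0}
    (ℚᵘ.*≡* (cong (ℤ._* ℤ.+ 1)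
      (sym (cong₂ ℤ._+_ (ℤP.*-identityʳ (ℤ.+ m)) (ℤP.*-identityʳ (ℤ.+ n)))))))
  (fromℚᵘ-homo-+ (mkℚᵘ (ℤ.+ m) 0) (mkℚᵘ (ℤ.+ n) 0))

ℕ→ℚ-* : ∀ m n → ℕ→ℚ (m ℕ.* n) ≡ ℕ→ℚ m * ℕ→ℚ n
ℕ→ℚ-* m n = trans
  (fromℚᵘ-cong {mkℚᵘ (ℤ.+ (m ℕ.* n)) 0} {mkℚᵘ (ℤ.+ m) 0 ℚᵘ.* mkℚᵘ (ℤ.+ n) 0}
    (ℚᵘ.*≡* (cong (ℤ._* ℤ.+ 1) (ℤP.pos-* m n))))
  (fromℚᵘ-homo-* (mkℚᵘ (ℤ.+ m) 0) (mkℚᵘ (ℤ.+ n) 0))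

ℕ→ℚ-suc : ∀ n → ℕ→ℚ (suc n) ≡ 1ℚ + ℕ→ℚ n
ℕ→ℚ-suc = ℕ→ℚ-+ 1

ℕ→ℚ-mono : ∀ {m n} → m ℕ.≤ n → ℕ→ℚ m ≤ ℕ→ℚ n
ℕ→ℚ-mono {m} {n} m≤n = toℚᵘ-cancel-≤
  (ℚᵘP.≤-respˡ-≃ (ℚᵘP.≃-sym (toℚᵘ-fromℚᵘ (mkℚᵘ (ℤ.+ m) 0)))
  (ℚᵘP.≤-respʳ-≃ (ℚᵘP.≃-sym (toℚᵘ-fromℚᵘ (mkℚᵘ (ℤ.+ n) 0)))
    (ℚᵘ.*≤* (ℤP.*-monoʳ-≤-nonNeg (ℤ.+ 1) (ℤ.+≤+ m≤n)))))

ℕ→ℚ-nonneg : ∀ n → 0ℚ ≤ ℕ→ℚ n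
ℕ→ℚ-nonneg n = ℕ→ℚ-mono {0} {n} z≤n

1/ℕ-inverse : ∀ n → ℕ→ℚ (suc n) * 1/ℕ (suc n) ≡ 1ℚ
1/ℕ-inverse n = trans
  (sym (fromℚᵘ-homo-* (mkℚᵘ (ℤ.+ suc n) 0) (mkℚᵘ (ℤ.+ 1) n)))
  (fromℚᵘ-cong {mkℚᵘ (ℤ.+ suc n) 0 ℚᵘ.* mkℚᵘ (ℤ.+ 1) n} {mkℚᵘ (ℤ.+ 1) 0}
    (ℚᵘ.*≡* (trans (ℤP.*-identityʳ _) (trans (ℤP.*-identityʳ (ℤ.+ suc n))
      (sym (trans (ℤP.*-identityˡ _) (cong (λ x → ℤ.+ suc x) (ℕP.+-identityʳ n))))))))

1/ℕ-pos : ∀ n → Positive (1/ℕ (suc n))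
1/ℕ-pos n = normalize-pos 1 (suc n)

1/ℕ-nonneg : ∀ n → 0ℚ ≤ 1/ℕ n
1/ℕ-nonneg zero = ≤-refl
1/ℕ-nonneg (suc n) = <⇒≤ (positive⁻¹ (1/ℕ (suc n)) {{1/ℕ-pos n}})

*-monoˡ : ∀ {x y z} → 0ℚ ≤ z → x ≤ y → z * x ≤ z * y
*-monoˡ {z = z} 0≤z = *-monoˡ-≤-nonNeg z {{nonNegative 0≤z}}

*-nonneg : ∀ {x y} → 0ℚ ≤ x → 0ℚ ≤ y → 0ℚ ≤ x * y
*-nonneg {x} {y} 0≤x 0≤y = subst (_≤ x * y) (*-zeroʳ x) (*-monoˡ 0≤x 0≤y)

x≤y⇒0≤y-x : ∀ {x y} → x ≤ y → 0ℚ ≤ y - x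
x≤y⇒0≤y-x {x} {y} x≤y = subst (_≤ y - x) (+-inverseʳ x) (+-monoˡ-≤ (- x) x≤y)

0≤y-x⇒x≤y : ∀ {x y} → 0ℚ ≤ y - x → x ≤ y
0≤y-x⇒x≤y {x} {y} 0≤y-x = subst₂ _≤_ (+-identityˡ x)
  (solve 2 (λ x y → y :- x :+ x := y) refl x y) (+-monoˡ-≤ x 0≤y-x)

1/ℕ-unique : ∀ {n x} → 1 ℕ.≤ n → ℕ→ℚ n * x ≡ 1ℚ → x ≡ 1/ℕ n
1/ℕ-unique {suc n} {x} _ eq = begin
  x                                          ≡⟨ *-identityʳ x ⟨
  x * 1ℚ                                     ≡⟨ cong (x *_) (1/ℕ-inverse n) ⟨
  x * (ℕ→ℚ (suc n) * 1/ℕ (suc n))            ≡⟨ solve 3 (λ x a b → x :* (a :* b) := a :* x :* b) refl x (ℕ→ℚ (suc n)) (1/ℕ (suc n)) ⟩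
  ℕ→ℚ (suc n) * x * 1/ℕ (suc n)              ≡⟨ cong (_* 1/ℕ (suc n)) eq ⟩
  1ℚ * 1/ℕ (suc n)                           ≡⟨ *-identityˡ _ ⟩
  1/ℕ (suc n)                                ∎
  where open ≡-Reasoning

1/ℕ-* : ∀ m n → 1/ℕ (suc m ℕ.* suc n) ≡ 1/ℕ (suc m) * 1/ℕ (suc n)
1/ℕ-* m n = sym (1/ℕ-unique {suc m ℕ.* suc n} (s≤s z≤n) (begin
  ℕ→ℚ (suc m ℕ.* suc n) * (a * b)            ≡⟨ cong (_* (a * b)) (ℕ→ℚ-* (suc m) (suc n)) ⟩
  ℕ→ℚ (suc m) * ℕ→ℚ (suc n) * (a * b)        ≡⟨ solve 4 (λ x y a b → x :* y :* (a :* b) := x :* a :* (y :* b)) refl (ℕ→ℚ (suc m)) (ℕ→ℚ (suc n)) a b ⟩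
  ℕ→ℚ (suc m) * a * (ℕ→ℚ (suc n) * b)        ≡⟨ cong₂ _*_ (1/ℕ-inverse m) (1/ℕ-inverse n) ⟩
  1ℚ * 1ℚ                                    ≡⟨⟩
  1ℚ                                         ∎))
  where open ≡-Reasoning
        a = 1/ℕ (suc m)
        b = 1/ℕ (suc n)

1/ℕ-telescope : ∀ n → 1/ℕ (suc n) - 1/ℕ (suc (suc n)) ≡ 1/ℕ (suc n) * 1/ℕ (suc (suc n))
1/ℕ-telescope n = begin
  a - b                                      ≡⟨ cong₂ _-_ (*-identityʳ a) (*-identityʳ b) ⟨
  a * 1ℚ - b * 1ℚ                            ≡⟨ cong₂ (λ x y → a * x - b * y)
                                                  (trans (cong (_* b) (sym (ℕ→ℚ-suc (suc n)))) (1/ℕ-inverse (suc n)))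
                                                  (1/ℕ-inverse n) ⟨
  a * ((1ℚ + x) * b) - b * (x * a)           ≡⟨ solve 3 (λ a b x → a :* ((con 1ℚ :+ x) :* b) :- b :* (x :* a) := a :* b) refl a b x ⟩
  a * b                                      ∎
  where open ≡-Reasoning
        a = 1/ℕ (suc n)
        b = 1/ℕ (suc (suc n))
        x = ℕ→ℚ (suc n)

1/ℕ-antitone : ∀ n → 1/ℕ (suc (suc n)) ≤ 1/ℕ (suc n)
1/ℕ-antitone n = 0≤y-x⇒x≤y (subst (0ℚ ≤_) (sym (1/ℕ-telescope n))
  (*-nonneg (1/ℕ-nonneg (suc n)) (1/ℕ-nonneg (suc (suc n)))))

1/ℕ≤1 : ∀ n → 1/ℕ n ≤ 1ℚ
1/ℕ≤1 zero = ℕ→ℚ-nonneg 1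
1/ℕ≤1 (suc zero) = ≤-refl
1/ℕ≤1 (suc (suc n)) = ≤-trans (1/ℕ-antitone n) (1/ℕ≤1 (suc n))

1/ℕ-inverse-≥1 : ∀ {n} → 1 ℕ.≤ n → ℕ→ℚ n * 1/ℕ n ≡ 1ℚ
1/ℕ-inverse-≥1 {suc n} _ = 1/ℕ-inverse n

cancel-1/ℕ : ∀ i x → 1/ℕ (suc i) * (ℕ→ℚ (suc i) * x) ≡ x
cancel-1/ℕ i x = begin
  1/ℕ (suc i) * (ℕ→ℚ (suc i) * x)  ≡⟨ solve 3 (λ r y x → r :* (y :* x) := y :* r :* x) refl (1/ℕ (suc i)) (ℕ→ℚ (suc i)) x ⟩
  ℕ→ℚ (suc i) * 1/ℕ (suc i) * x    ≡⟨ cong (_* x) (1/ℕ-inverse i) ⟩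
  1ℚ * x                           ≡⟨ *-identityˡ x ⟩
  x                                ∎
  where open ≡-Reasoning

-- The cost of a profile

+-nonneg : ∀ {x y} → 0ℚ ≤ x → 0ℚ ≤ y → 0ℚ ≤ x + y
+-nonneg = +-mono-≤

pair-step : ∀ i {e M s₀ s₁ s₂} → 1 ℕ.≤ i → 0ℚ ≤ e → 0ℚ ≤ M →
  s₀ ≤ ℕ→ℚ i * M → s₁ + s₀ ≤ (ℕ→ℚ 2 * ℕ→ℚ i + e) * M →
  1/ℕ i * s₀ + 1/ℕ (1 ℕ.+ i) * (s₁ - s₀) + 1/ℕ (2 ℕ.+ i) * (s₂ - s₁)
    ≤ 1/ℕ (2 ℕ.+ i) * s₂ + (ℕ→ℚ 2 * 1/ℕ (2 ℕ.+ i) + e) * M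
pair-step (suc i) {e} {M} {s₀} {s₁} {s₂} _ 0≤e 0≤M row pair =
  0≤y-x⇒x≤y (subst (0ℚ ≤_) (sym identity)
    (+-nonneg (+-nonneg (*-nonneg (x≤y⇒0≤y-x (1/ℕ-antitone (suc i))) (x≤y⇒0≤y-x pair))
                        (*-nonneg convex (x≤y⇒0≤y-x row)))
              (*-nonneg (*-nonneg 0≤M 0≤e)
                (+-nonneg (x≤y⇒0≤y-x (1/ℕ≤1 (2 ℕ.+ i))) (1/ℕ-nonneg (3 ℕ.+ i))))))
  where
  x r u v : ℚ
  x = ℕ→ℚ (suc i)
  r = 1/ℕ (suc i)
  u = 1/ℕ (suc (suc i))
  v = 1/ℕ (suc (suc (suc i)))
  convex : 0ℚ ≤ (r - u) - (u - v)
  convex = subst (0ℚ ≤_)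
    (begin
      u * (r - v)    ≡⟨ solve 3 (λ u r v → u :* (r :- v) := r :* u :- u :* v) refl u r v ⟩
      r * u - u * v  ≡⟨ cong₂ _-_ (1/ℕ-telescope i) (1/ℕ-telescope (suc i)) ⟨
      (r - u) - (u - v) ∎)
    (*-nonneg (1/ℕ-nonneg (suc (suc i)))
      (x≤y⇒0≤y-x (≤-trans (1/ℕ-antitone (suc i)) (1/ℕ-antitone i))))
    where open ≡-Reasoning
  v-inverse : (ℕ→ℚ 2 + x) * v ≡ 1ℚ
  v-inverse = trans (cong (_* v) (sym (ℕ→ℚ-+ 2 (suc i)))) (1/ℕ-inverse (2 ℕ.+ i))
  main = (u - v) * ((ℕ→ℚ 2 * x + e) * M - (s₁ + s₀))
         + ((r - u) - (u - v)) * (x * M - s₀) + M * e * ((1ℚ - u) + v)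
  identity : v * s₂ + (ℕ→ℚ 2 * v + e) * M - (r * s₀ + u * (s₁ - s₀) + v * (s₂ - s₁)) ≡ main
  identity = begin
    v * s₂ + (ℕ→ℚ 2 * v + e) * M - (r * s₀ + u * (s₁ - s₀) + v * (s₂ - s₁))
      ≡⟨ solve 9 (λ x r u v e M s₀ s₁ s₂ →
           v :* s₂ :+ (con (ℕ→ℚ 2) :* v :+ e) :* M :- (r :* s₀ :+ u :* (s₁ :- s₀) :+ v :* (s₂ :- s₁))
           := (u :- v) :* ((con (ℕ→ℚ 2) :* x :+ e) :* M :- (s₁ :+ s₀))
              :+ ((r :- u) :- (u :- v)) :* (x :* M :- s₀) :+ M :* e :* ((con 1ℚ :- u) :+ v)
              :+ M :* ((con (ℕ→ℚ 2) :+ x) :* v :- x :* r))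
           refl x r u v e M s₀ s₁ s₂ ⟩
    main + M * ((ℕ→ℚ 2 + x) * v - x * r)
      ≡⟨ cong₂ (λ y z → main + M * (y - z)) v-inverse (1/ℕ-inverse i) ⟩
    main + M * (1ℚ - 1ℚ)  ≡⟨ cong (main +_) (*-zeroʳ M) ⟩
    main + 0ℚ             ≡⟨ +-identityʳ main ⟩
    main                  ∎
    where open ≡-Reasoning

last-step : ∀ i {e M s₀ s₁} → 1 ℕ.≤ i → 0ℚ ≤ e → 0ℚ ≤ M →
  s₁ ≤ ℕ→ℚ (suc i) * M → s₁ + s₀ ≤ (ℕ→ℚ 2 * ℕ→ℚ i + e) * M →
  1/ℕ i * s₀ + 1/ℕ (suc i) * (s₁ - s₀) ≤ (1ℚ + 1/ℕ (suc i) - 1/ℕ i * 1/ℕ (suc i) + e) * M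
last-step (suc i) {e} {M} {s₀} {s₁} _ 0≤e 0≤M row pair =
  0≤y-x⇒x≤y (subst (0ℚ ≤_) (sym identity)
    (+-nonneg (+-nonneg (*-nonneg (x≤y⇒0≤y-x (1/ℕ-antitone i)) (x≤y⇒0≤y-x pair))
                        (*-nonneg convex (x≤y⇒0≤y-x row)))
              (*-nonneg (*-nonneg 0≤M 0≤e)
                (+-nonneg (x≤y⇒0≤y-x (1/ℕ≤1 (suc i))) (1/ℕ-nonneg (2 ℕ.+ i))))))
  where
  x r u y : ℚ
  x = ℕ→ℚ (suc i)
  y = ℕ→ℚ (suc (suc i))
  r = 1/ℕ (suc i)
  u = 1/ℕ (suc (suc i))
  convex : 0ℚ ≤ u - (r - u)
  convex = subst (0ℚ ≤_)
    (begin
      u * (1ℚ - r)  ≡⟨ solve 2 (λ u r → u :* (con 1ℚ :- r) := u :- r :* u) refl u r ⟩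
      u - r * u     ≡⟨ cong (λ z → u - z) (1/ℕ-telescope i) ⟨
      u - (r - u)   ∎)
    (*-nonneg (1/ℕ-nonneg (suc (suc i))) (x≤y⇒0≤y-x (1/ℕ≤1 (suc i))))
    where open ≡-Reasoning
  main = (r - u) * ((ℕ→ℚ 2 * x + e) * M - (s₁ + s₀))
         + (u - (r - u)) * (y * M - s₁) + M * e * ((1ℚ - r) + u)
  identity : (1ℚ + u - r * u + e) * M - (r * s₀ + u * (s₁ - s₀)) ≡ main
  identity = begin
    (1ℚ + u - r * u + e) * M - (r * s₀ + u * (s₁ - s₀))
      ≡⟨ cong (λ z → (1ℚ + u - z + e) * M - (r * s₀ + u * (s₁ - s₀))) (1/ℕ-telescope i) ⟨
    (1ℚ + u - (r - u) + e) * M - (r * s₀ + u * (s₁ - s₀))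
      ≡⟨ solve 7 (λ x r u e M s₀ s₁ →
           (con 1ℚ :+ u :- (r :- u) :+ e) :* M :- (r :* s₀ :+ u :* (s₁ :- s₀))
           := (r :- u) :* ((con (ℕ→ℚ 2) :* x :+ e) :* M :- (s₁ :+ s₀))
              :+ (u :- (r :- u)) :* ((con 1ℚ :+ x) :* M :- s₁) :+ M :* e :* ((con 1ℚ :- r) :+ u)
              :+ M :* (con 1ℚ :- x :* r))
           refl x r u e M s₀ s₁ ⟩
    (r - u) * ((ℕ→ℚ 2 * x + e) * M - (s₁ + s₀))
      + (u - (r - u)) * ((1ℚ + x) * M - s₁) + M * e * ((1ℚ - r) + u) + M * (1ℚ - x * r)
      ≡⟨ cong₂ (λ a b → (r - u) * ((ℕ→ℚ 2 * x + e) * M - (s₁ + s₀))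
           + (u - (r - u)) * (a * M - s₁) + M * e * ((1ℚ - r) + u) + M * (1ℚ - b))
           (sym (ℕ→ℚ-suc (suc i))) (1/ℕ-inverse i) ⟩
    main + M * (1ℚ - 1ℚ)  ≡⟨ cong (main +_) (*-zeroʳ M) ⟩
    main + 0ℚ             ≡⟨ +-identityʳ main ⟩
    main                  ∎
    where open ≡-Reasoning

-- A profile records the number s of units left before phase n + p, relative
-- to a scale M, together with the cost of serving them at rate 1 / i in phase i.
data Profile (p : ℕ) (e M : ℚ) : ℕ → ℚ → ℚ → Set where
  start : ∀ {s} → s ≤ ℕ→ℚ p * M → Profile p e M 0 s (1/ℕ p * s)
  step : ∀ {n s s′ v} → Profile p e M n s v →
         s′ ≤ ℕ→ℚ (suc (n ℕ.+ p)) * M →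
         s′ + s ≤ (ℕ→ℚ 2 * ℕ→ℚ (n ℕ.+ p) + e) * M →
         Profile p e M (suc n) s′ (v + 1/ℕ (suc (n ℕ.+ p)) * (s′ - s))

pairSum : ℕ → ℕ → ℚ
pairSum p zero    = 0ℚ
pairSum p (suc q) = pairSum p q + ℕ→ℚ 2 * 1/ℕ (2 ℕ.+ (q ℕ.* 2 ℕ.+ p))

module _ {p : ℕ} {e M : ℚ} (1≤p : 1 ℕ.≤ p) (0≤e : 0ℚ ≤ e) (0≤M : 0ℚ ≤ M) where

  1≤i : ∀ n → 1 ℕ.≤ n ℕ.+ p
  1≤i n = ℕP.≤-trans 1≤p (ℕP.m≤n+m p n)

  row-bound : ∀ {n s v} → Profile p e M n s v → s ≤ ℕ→ℚ (n ℕ.+ p) * M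
  row-bound (start s≤)     = s≤
  row-bound (step _ s≤ _) = s≤

  profile-even : ∀ q {s v} → Profile p e M (q ℕ.* 2) s v →
    v ≤ 1/ℕ (q ℕ.* 2 ℕ.+ p) * s + (pairSum p q + ℕ→ℚ q * e) * M
  profile-even zero {s} (start _) = ≤-reflexive
    (solve 3 (λ v e M → v := v :+ (con 0ℚ :+ con 0ℚ :* e) :* M) refl (1/ℕ p * s) e M)
  profile-even (suc q) (step {s = s₁} {s′ = s₂} (step {s = s₀} {v = v₀} P _ pair) _ _) = begin
    v₀ + u * (s₁ - s₀) + v * (s₂ - s₁)
      ≤⟨ +-monoˡ-≤ (v * (s₂ - s₁)) (+-monoˡ-≤ (u * (s₁ - s₀)) (profile-even q P)) ⟩
    r * s₀ + (S + Q * e) * M + u * (s₁ - s₀) + v * (s₂ - s₁)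
      ≡⟨ solve 4 (λ a b c d → a :+ b :+ c :+ d := a :+ c :+ d :+ b) refl
           (r * s₀) ((S + Q * e) * M) (u * (s₁ - s₀)) (v * (s₂ - s₁)) ⟩
    r * s₀ + u * (s₁ - s₀) + v * (s₂ - s₁) + (S + Q * e) * M
      ≤⟨ +-monoˡ-≤ ((S + Q * e) * M)
           (pair-step i {s₂ = s₂} (1≤i (q ℕ.* 2)) 0≤e 0≤M (row-bound P) pair) ⟩
    v * s₂ + (ℕ→ℚ 2 * v + e) * M + (S + Q * e) * M
      ≡⟨ solve 6 (λ a v e M S Q → a :+ (con (ℕ→ℚ 2) :* v :+ e) :* M :+ (S :+ Q :* e) :* M
           := a :+ (S :+ con (ℕ→ℚ 2) :* v :+ (con 1ℚ :+ Q) :* e) :* M) refl (v * s₂) v e M S Q ⟩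
    v * s₂ + (S + ℕ→ℚ 2 * v + (1ℚ + Q) * e) * M
      ≡⟨ cong (λ z → v * s₂ + (S + ℕ→ℚ 2 * v + z * e) * M) (sym (ℕ→ℚ-suc q)) ⟩
    v * s₂ + (S + ℕ→ℚ 2 * v + ℕ→ℚ (suc q) * e) * M ∎
    where
    open ≤-Reasoning
    i = q ℕ.* 2 ℕ.+ p
    r = 1/ℕ i
    u = 1/ℕ (1 ℕ.+ i)
    v = 1/ℕ (2 ℕ.+ i)
    S = pairSum p q
    Q = ℕ→ℚ q

  even-bound : ∀ q {s v} → Profile p e M (q ℕ.* 2) s v →
    v ≤ (1ℚ + pairSum p q + ℕ→ℚ q * e) * M
  even-bound q {s} {v} P = begin
    v                                   ≤⟨ profile-even q P ⟩
    r * s + (S + Q * e) * M             ≤⟨ +-monoˡ-≤ ((S + Q * e) * M) (*-monoˡ (1/ℕ-nonneg i) (row-bound P)) ⟩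
    r * (ℕ→ℚ i * M) + (S + Q * e) * M   ≡⟨ solve 6 (λ r x M S Q e → r :* (x :* M) :+ (S :+ Q :* e) :* M
                                             := (x :* r :+ S :+ Q :* e) :* M) refl r (ℕ→ℚ i) M S Q e ⟩
    (ℕ→ℚ i * r + S + Q * e) * M         ≡⟨ cong (λ z → (z + S + Q * e) * M) (1/ℕ-inverse-≥1 (1≤i (q ℕ.* 2))) ⟩
    (1ℚ + S + Q * e) * M                ∎
    where
    open ≤-Reasoning
    i = q ℕ.* 2 ℕ.+ p
    r = 1/ℕ i
    S = pairSum p q
    Q = ℕ→ℚ q

  odd-bound : ∀ q {s v} → Profile p e M (suc (q ℕ.* 2)) s v →
    let i = q ℕ.* 2 ℕ.+ p in
    v ≤ (1ℚ + 1/ℕ (suc i) - 1/ℕ i * 1/ℕ (suc i) + pairSum p q + ℕ→ℚ (suc q) * e) * M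
  odd-bound q {s₁} (step {s = s₀} {v = v₀} P row pair) = begin
    v₀ + u * (s₁ - s₀)
      ≤⟨ +-monoˡ-≤ (u * (s₁ - s₀)) (profile-even q P) ⟩
    r * s₀ + (S + Q * e) * M + u * (s₁ - s₀)
      ≡⟨ solve 3 (λ a b c → a :+ b :+ c := a :+ c :+ b) refl
           (r * s₀) ((S + Q * e) * M) (u * (s₁ - s₀)) ⟩
    r * s₀ + u * (s₁ - s₀) + (S + Q * e) * M
      ≤⟨ +-monoˡ-≤ ((S + Q * e) * M) (last-step i (1≤i (q ℕ.* 2)) 0≤e 0≤M row pair) ⟩
    (1ℚ + u - r * u + e) * M + (S + Q * e) * M
      ≡⟨ solve 5 (λ a e M S Q → (a :+ e) :* M :+ (S :+ Q :* e) :* M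
           := (a :+ S :+ (con 1ℚ :+ Q) :* e) :* M) refl (1ℚ + u - r * u) e M S Q ⟩
    (1ℚ + u - r * u + S + (1ℚ + Q) * e) * M
      ≡⟨ cong (λ z → (1ℚ + u - r * u + S + z * e) * M) (sym (ℕ→ℚ-suc q)) ⟩
    (1ℚ + u - r * u + S + ℕ→ℚ (suc q) * e) * M ∎
    where
    open ≤-Reasoning
    i = q ℕ.* 2 ℕ.+ p
    r = 1/ℕ i
    u = 1/ℕ (1 ℕ.+ i)
    S = pairSum p q
    Q = ℕ→ℚ q

-- Sums and harmonic numbers

sum-upTo-suc : ∀ (g : ℕ → ℚ) n → foldr _+_ 0ℚ (map g (upTo (suc n))) ≡ foldr _+_ 0ℚ (map g (upTo n)) + g n
sum-upTo-suc g n = begin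
  foldr _+_ 0ℚ (map g (upTo (suc n)))          ≡⟨ cong (λ l → foldr _+_ 0ℚ (map g l)) (upTo-∷ʳ n) ⟨
  foldr _+_ 0ℚ (map g (upTo n ++ n ∷ []))      ≡⟨ cong (foldr _+_ 0ℚ) (map-++ g (upTo n) (n ∷ [])) ⟩
  foldr _+_ 0ℚ (map g (upTo n) ++ g n ∷ [])    ≡⟨ foldr-++ _+_ 0ℚ (map g (upTo n)) (g n ∷ []) ⟩
  foldr _+_ (g n + 0ℚ) (map g (upTo n))        ≡⟨ last (map g (upTo n)) ⟩
  foldr _+_ 0ℚ (map g (upTo n)) + g n          ∎
  where
  open ≡-Reasoning
  last : ∀ l → foldr _+_ (g n + 0ℚ) l ≡ foldr _+_ 0ℚ l + g n
  last []      = +-comm (g n) 0ℚ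
  last (x ∷ l) = trans (cong (x +_) (last l)) (sym (+-assoc x (foldr _+_ 0ℚ l) (g n)))

∑-empty : ∀ {m n} f → n ℕ.< m → ∑ m n f ≡ 0ℚ
∑-empty {m} {n} f n<m rewrite ℕP.m≤n⇒m∸n≡0 n<m = refl

∑-suc : ∀ {m n} f → m ℕ.≤ suc n → ∑ m (suc n) f ≡ ∑ m n f + f (suc n)
∑-suc {m} {n} f m≤1+n rewrite ℕP.+-∸-assoc 1 m≤1+n = trans
  (sum-upTo-suc (λ i → f (m ℕ.+ i)) (suc n ∸ m))
  (cong (λ i → ∑ m n f + f i) (ℕP.m+[n∸m]≡n m≤1+n))

∑₁-suc : ∀ n f → ∑ 1 (suc n) f ≡ ∑ 1 n f + f (suc n)
∑₁-suc n f = ∑-suc {1} {n} f (s≤s z≤n)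

H-suc : ∀ n → H (suc n) ≡ H n + 1/ℕ (suc n)
H-suc n = ∑₁-suc n 1/ℕ

1/ℕ-*-≥1 : ∀ {m n} → 1 ℕ.≤ m → 1 ℕ.≤ n → 1/ℕ (m ℕ.* n) ≡ 1/ℕ m * 1/ℕ n
1/ℕ-*-≥1 {suc m} {suc n} _ _ = 1/ℕ-* m n

1/ℕ-double : ∀ n → ℕ→ℚ 2 * 1/ℕ (suc n ℕ.* 2) ≡ 1/ℕ (suc n)
1/ℕ-double n = trans (cong (ℕ→ℚ 2 *_) (1/ℕ-* n 1))
  (solve 1 (λ x → con (ℕ→ℚ 2) :* (x :* con (1/ℕ 2)) := x) refl (1/ℕ (suc n)))

parity-double-+ : ∀ q m → parity (q ℕ.* 2 ℕ.+ m) ≡ parity m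
parity-double-+ zero    m = refl
parity-double-+ (suc q) m = parity-double-+ q m

⌊double-+/2⌋ : ∀ q m → ⌊ q ℕ.* 2 ℕ.+ m /2⌋ ≡ q ℕ.+ ⌊ m /2⌋
⌊double-+/2⌋ zero    m = refl
⌊double-+/2⌋ (suc q) m = cong suc (⌊double-+/2⌋ q m)

parity-double : ∀ u → parity (u ℕ.* 2) ≡ 0ℙ
parity-double zero    = refl
parity-double (suc u) = parity-double u

parity-suc-double : ∀ u → parity (suc (u ℕ.* 2)) ≡ 1ℙ
parity-suc-double zero    = refl
parity-suc-double (suc u) = parity-suc-double u

⌊double/2⌋ : ∀ u → ⌊ u ℕ.* 2 /2⌋ ≡ u
⌊double/2⌋ zero    = refl
⌊double/2⌋ (suc u) = cong suc (⌊double/2⌋ u)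

even⊎odd : ∀ n → ∃[ q ] (n ≡ q ℕ.* 2 ⊎ n ≡ suc (q ℕ.* 2))
even⊎odd zero = 0 , inj₁ refl
even⊎odd (suc n) with even⊎odd n
... | q , inj₁ refl = q , inj₂ refl
... | q , inj₂ refl = suc q , inj₁ refl

pairSum-even : ∀ u q → pairSum (u ℕ.* 2) q ≡ H (q ℕ.+ u) - H u
pairSum-even u zero    = sym (+-inverseʳ (H u))
pairSum-even u (suc q) = begin
  pairSum (u ℕ.* 2) q + ℕ→ℚ 2 * 1/ℕ (2 ℕ.+ (q ℕ.* 2 ℕ.+ u ℕ.* 2))
    ≡⟨ cong₂ (λ x i → x + ℕ→ℚ 2 * 1/ℕ (2 ℕ.+ i)) (pairSum-even u q) (sym (ℕP.*-distribʳ-+ 2 q u)) ⟩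
  H (q ℕ.+ u) - H u + ℕ→ℚ 2 * 1/ℕ (suc (q ℕ.+ u) ℕ.* 2)
    ≡⟨ cong (λ x → H (q ℕ.+ u) - H u + x) (1/ℕ-double (q ℕ.+ u)) ⟩
  H (q ℕ.+ u) - H u + c
    ≡⟨ solve 3 (λ a b c → a :- b :+ c := a :+ c :- b) refl (H (q ℕ.+ u)) (H u) c ⟩
  H (q ℕ.+ u) + c - H u
    ≡⟨ cong (_- H u) (H-suc (q ℕ.+ u)) ⟨
  H (suc q ℕ.+ u) - H u ∎
  where open ≡-Reasoning
        c = 1/ℕ (suc (q ℕ.+ u))

pairSum-odd : ∀ u q → let p = suc (u ℕ.* 2) in
  pairSum p q ≡ ℕ→ℚ 2 * (H (suc (q ℕ.* 2 ℕ.+ p)) - H (suc p)) - H (q ℕ.+ suc u) + H (suc u)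
pairSum-odd u zero    = solve 2 (λ a b → con 0ℚ := con (ℕ→ℚ 2) :* (a :- a) :- b :+ b) refl
  (H (suc (suc (u ℕ.* 2)))) (H (suc u))
pairSum-odd u (suc q) = begin
  pairSum p q + ℕ→ℚ 2 * a
    ≡⟨ cong (_+ ℕ→ℚ 2 * a) (pairSum-odd u q) ⟩
  ℕ→ℚ 2 * (h - hp) - g + gu + ℕ→ℚ 2 * a
    ≡⟨ solve 6 (λ h hp g gu a b → con (ℕ→ℚ 2) :* (h :- hp) :- g :+ gu :+ con (ℕ→ℚ 2) :* a
         := con (ℕ→ℚ 2) :* (h :+ a :+ b :- hp) :- (g :+ con (ℕ→ℚ 2) :* b) :+ gu) refl h hp g gu a b ⟩
  ℕ→ℚ 2 * (h + a + b - hp) - (g + ℕ→ℚ 2 * b) + gu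
    ≡⟨ cong₂ (λ x y → ℕ→ℚ 2 * (x - hp) - (g + y) + gu)
         (sym (trans (H-suc (2 ℕ.+ i)) (cong (_+ b) (H-suc (suc i)))))
         (trans (cong (λ j → ℕ→ℚ 2 * 1/ℕ j) 3+i) (1/ℕ-double (q ℕ.+ suc u))) ⟩
  ℕ→ℚ 2 * (H (3 ℕ.+ i) - hp) - (g + 1/ℕ (suc (q ℕ.+ suc u))) + gu
    ≡⟨ cong (λ x → ℕ→ℚ 2 * (H (3 ℕ.+ i) - hp) - x + gu) (H-suc (q ℕ.+ suc u)) ⟨
  ℕ→ℚ 2 * (H (3 ℕ.+ i) - hp) - H (suc q ℕ.+ suc u) + gu ∎
  where
  open ≡-Reasoning
  p = suc (u ℕ.* 2)
  i = q ℕ.* 2 ℕ.+ p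
  h = H (suc i)
  hp = H (suc p)
  g = H (q ℕ.+ suc u)
  gu = H (suc u)
  a = 1/ℕ (2 ℕ.+ i)
  b = 1/ℕ (3 ℕ.+ i)
  3+i : 3 ℕ.+ i ≡ suc (q ℕ.+ suc u) ℕ.* 2
  3+i = cong (2 ℕ.+_) (trans (sym (ℕP.+-suc (q ℕ.* 2) p)) (sym (ℕP.*-distribʳ-+ 2 q (suc u))))

ρ-even : ∀ p q → ρ p (q ℕ.* 2 ℕ.+ p) ≡ 1ℚ + pairSum p q
ρ-even p q with even⊎odd p
... | u , inj₁ refl = begin
  ρ (u ℕ.* 2) k
    ≡⟨ cong₂ (λ a b → ρ-cases a b (u ℕ.* 2) k) (parity-double u)
         (trans (parity-double-+ q (u ℕ.* 2)) (parity-double u)) ⟩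
  H ⌊ k /2⌋ - H ⌊ u ℕ.* 2 /2⌋ + 1ℚ
    ≡⟨ cong₂ (λ a b → H a - H b + 1ℚ)
         (trans (⌊double-+/2⌋ q (u ℕ.* 2)) (cong (q ℕ.+_) (⌊double/2⌋ u))) (⌊double/2⌋ u) ⟩
  H (q ℕ.+ u) - H u + 1ℚ
    ≡⟨ +-comm (H (q ℕ.+ u) - H u) 1ℚ ⟩
  1ℚ + (H (q ℕ.+ u) - H u)
    ≡⟨ cong (1ℚ +_) (pairSum-even u q) ⟨
  1ℚ + pairSum (u ℕ.* 2) q ∎
  where open ≡-Reasoning
        k = q ℕ.* 2 ℕ.+ u ℕ.* 2
... | u , inj₂ refl = begin
  ρ p k
    ≡⟨ cong₂ (λ a b → ρ-cases a b p k) (parity-suc-double u)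
         (trans (parity-double-+ q p) (parity-suc-double u)) ⟩
  ℕ→ℚ 2 * (H (k ℕ.+ 1) - H (p ℕ.+ 1)) - H ⌊ k ℕ.+ 1 /2⌋ + H ⌊ p ℕ.+ 1 /2⌋ + 1ℚ
    ≡⟨ cong₂ (λ a b → ℕ→ℚ 2 * (H a - H b) - H ⌊ a /2⌋ + H ⌊ b /2⌋ + 1ℚ) (ℕP.+-comm k 1) (ℕP.+-comm p 1) ⟩
  ℕ→ℚ 2 * (H (suc k) - H (suc p)) - H ⌊ suc k /2⌋ + H ⌊ suc p /2⌋ + 1ℚ
    ≡⟨ cong₂ (λ a b → ℕ→ℚ 2 * (H (suc k) - H (suc p)) - H a + H b + 1ℚ)
         (trans (cong ⌊_/2⌋ (sym (ℕP.+-suc (q ℕ.* 2) p)))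
           (trans (⌊double-+/2⌋ q (suc p)) (cong (q ℕ.+_) (⌊double/2⌋ (suc u)))))
         (⌊double/2⌋ (suc u)) ⟩
  ℕ→ℚ 2 * (H (suc k) - H (suc p)) - H (q ℕ.+ suc u) + H (suc u) + 1ℚ
    ≡⟨ cong (_+ 1ℚ) (pairSum-odd u q) ⟨
  pairSum p q + 1ℚ
    ≡⟨ +-comm (pairSum p q) 1ℚ ⟩
  1ℚ + pairSum p q ∎
  where open ≡-Reasoning
        k = q ℕ.* 2 ℕ.+ p

ρ-odd : ∀ p q → 1 ℕ.≤ p → let i = q ℕ.* 2 ℕ.+ p in
  ρ p (suc i) ≡ 1ℚ + 1/ℕ (suc i) - 1/ℕ i * 1/ℕ (suc i) + pairSum p q
ρ-odd p q 1≤p with even⊎odd p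
... | u , inj₁ refl = begin
  ρ p k
    ≡⟨ cong₂ (λ a b → ρ-cases a b p k) (parity-double u)
         (trans (cong parity (sym (ℕP.+-suc (q ℕ.* 2) p)))
           (trans (parity-double-+ q (suc p)) (parity-suc-double u))) ⟩
  H ⌊ i /2⌋ - H ⌊ p /2⌋ + 1ℚ + 1/ℕ k - 1/ℕ (k ℕ.* i)
    ≡⟨ cong₂ (λ a b → H a - H b + 1ℚ + 1/ℕ k - 1/ℕ (k ℕ.* i))
         (trans (⌊double-+/2⌋ q p) (cong (q ℕ.+_) (⌊double/2⌋ u))) (⌊double/2⌋ u) ⟩
  H (q ℕ.+ u) - H u + 1ℚ + 1/ℕ k - 1/ℕ (k ℕ.* i)
    ≡⟨ cong₂ (λ a b → a + 1ℚ + 1/ℕ k - b) (sym (pairSum-even u q))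
         (1/ℕ-*-≥1 {k} {i} (s≤s z≤n) (ℕP.≤-trans 1≤p (ℕP.m≤n+m p (q ℕ.* 2)))) ⟩
  pairSum p q + 1ℚ + 1/ℕ k - 1/ℕ k * 1/ℕ i
    ≡⟨ solve 3 (λ s u r → s :+ con 1ℚ :+ u :- u :* r := con 1ℚ :+ u :- r :* u :+ s) refl
         (pairSum p q) (1/ℕ k) (1/ℕ i) ⟩
  1ℚ + 1/ℕ k - 1/ℕ i * 1/ℕ k + pairSum p q ∎
  where open ≡-Reasoning
        i = q ℕ.* 2 ℕ.+ p
        k = suc i
... | u , inj₂ refl = begin
  ρ p k
    ≡⟨ cong₂ (λ a b → ρ-cases a b p k) (parity-suc-double u)
         (trans (cong parity (sym (ℕP.+-suc (q ℕ.* 2) p)))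
           (trans (parity-double-+ q (suc p)) (parity-double (suc u)))) ⟩
  ℕ→ℚ 2 * (H k - H (p ℕ.+ 1)) - H ⌊ k /2⌋ + H ⌊ p ℕ.+ 1 /2⌋ + 1ℚ + 1/ℕ k - 1/ℕ (k ℕ.* i)
    ≡⟨ cong (λ b → ℕ→ℚ 2 * (H k - H b) - H ⌊ k /2⌋ + H ⌊ b /2⌋ + 1ℚ + 1/ℕ k - 1/ℕ (k ℕ.* i)) (ℕP.+-comm p 1) ⟩
  ℕ→ℚ 2 * (H k - H (suc p)) - H ⌊ k /2⌋ + H ⌊ suc p /2⌋ + 1ℚ + 1/ℕ k - 1/ℕ (k ℕ.* i)
    ≡⟨ cong₂ (λ a b → ℕ→ℚ 2 * (H k - H (suc p)) - H a + H b + 1ℚ + 1/ℕ k - 1/ℕ (k ℕ.* i))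
         (trans (cong ⌊_/2⌋ (sym (ℕP.+-suc (q ℕ.* 2) p)))
           (trans (⌊double-+/2⌋ q (suc p)) (cong (q ℕ.+_) (⌊double/2⌋ (suc u)))))
         (⌊double/2⌋ (suc u)) ⟩
  ℕ→ℚ 2 * (H k - H (suc p)) - H (q ℕ.+ suc u) + H (suc u) + 1ℚ + 1/ℕ k - 1/ℕ (k ℕ.* i)
    ≡⟨ cong₂ (λ a b → a + 1ℚ + 1/ℕ k - b) (sym (pairSum-odd u q))
         (1/ℕ-*-≥1 {k} {i} (s≤s z≤n) (ℕP.≤-trans 1≤p (ℕP.m≤n+m p (q ℕ.* 2)))) ⟩
  pairSum p q + 1ℚ + 1/ℕ k - 1/ℕ k * 1/ℕ i
    ≡⟨ solve 3 (λ s u r → s :+ con 1ℚ :+ u :- u :* r := con 1ℚ :+ u :- r :* u :+ s) refl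
         (pairSum p q) (1/ℕ k) (1/ℕ i) ⟩
  1ℚ + 1/ℕ k - 1/ℕ i * 1/ℕ k + pairSum p q ∎
  where open ≡-Reasoning
        i = q ℕ.* 2 ℕ.+ p
        k = suc i

-- Optimality in the linear program

∑-nonneg : ∀ n f → (∀ j → 1 ℕ.≤ j → j ℕ.≤ n → 0ℚ ≤ f j) → 0ℚ ≤ ∑ 1 n f
∑-nonneg zero    f 0≤f = ≤-refl
∑-nonneg (suc n) f 0≤f = subst (0ℚ ≤_) (sym (∑₁-suc n f))
  (+-nonneg (∑-nonneg n f (λ j 1≤j j≤n → 0≤f j 1≤j (ℕP.m≤n⇒m≤1+n j≤n)))
            (0≤f (suc n) (s≤s z≤n) ℕP.≤-refl))

weighted : (ℕ → ℚ) → ℕ → ℚ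
weighted f j = ℕ→ℚ j * f j

∑-weighted≤ : ∀ n f → (∀ j → 1 ℕ.≤ j → j ℕ.≤ n → 0ℚ ≤ f j) →
  ∑ 1 n (weighted f) ≤ ℕ→ℚ n * ∑ 1 n f
∑-weighted≤ zero    f 0≤f = ≤-refl
∑-weighted≤ (suc n) f 0≤f = begin
  ∑ 1 (suc n) (weighted f)        ≡⟨ ∑₁-suc n (weighted f) ⟩
  ∑ 1 n (weighted f) + N * x      ≤⟨ +-monoˡ-≤ (N * x) (∑-weighted≤ n f 0≤f′) ⟩
  ℕ→ℚ n * R + N * x               ≤⟨ +-monoˡ-≤ (N * x) (*-monoʳ-≤-nonNeg R {{nonNegative (∑-nonneg n f 0≤f′)}}
                                       (ℕ→ℚ-mono (ℕP.n≤1+n n))) ⟩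
  N * R + N * x                   ≡⟨ *-distribˡ-+ N R x ⟨
  N * (R + x)                     ≡⟨ cong (N *_) (∑₁-suc n f) ⟨
  N * ∑ 1 (suc n) f               ∎
  where
  open ≤-Reasoning
  N = ℕ→ℚ (suc n)
  x = f (suc n)
  R = ∑ 1 n f
  0≤f′ : ∀ j → 1 ℕ.≤ j → j ℕ.≤ n → 0ℚ ≤ f j
  0≤f′ j 1≤j j≤n = 0≤f j 1≤j (ℕP.m≤n⇒m≤1+n j≤n)

load : ℕ → Matrix → ℕ → ℚ
load p a zero    = ℕ→ℚ p * a p p
load p a (suc n) = ∑ 1 (suc n ℕ.+ p) (weighted (a (suc n ℕ.+ p)))

value : ℕ → (ℕ → ℚ) → ℕ → ℚ
value p s zero    = 1/ℕ p * s 0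
value p s (suc n) = value p s n + 1/ℕ (suc (n ℕ.+ p)) * (s (suc n) - s n)

module _ (p : ℕ) (a : Matrix) where

  middle : ℕ → ℚ
  middle n = ∑ (p ℕ.+ 1) (n ℕ.+ p)
      (λ i → 1/ℕ (i ℕ.* (i ℕ.+ 1)) * ∑ 1 i (weighted (a i)))

  middle-suc : ∀ n → let i = suc (n ℕ.+ p) in
    middle (suc n) ≡ middle n + (1/ℕ i - 1/ℕ (suc i)) * load p a (suc n)
  middle-suc n = trans
    (∑-suc {p ℕ.+ 1} {n ℕ.+ p} (λ i → 1/ℕ (i ℕ.* (i ℕ.+ 1)) * ∑ 1 i (weighted (a i)))
      (subst (ℕ._≤ suc (n ℕ.+ p)) (ℕP.+-comm 1 p) (s≤s (ℕP.m≤n+m p n))))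
    (cong (λ x → middle n + x * load p a (suc n)) weight)
    where
    i = suc (n ℕ.+ p)
    weight : 1/ℕ (i ℕ.* (i ℕ.+ 1)) ≡ 1/ℕ i - 1/ℕ (suc i)
    weight = trans (cong (λ j → 1/ℕ (i ℕ.* j)) (ℕP.+-comm i 1))
      (trans (1/ℕ-* (n ℕ.+ p) i) (sym (1/ℕ-telescope (n ℕ.+ p))))

  objective-value : 1 ℕ.≤ p → ∀ n → value p (load p a) (suc n) ≡ objective p (suc n ℕ.+ p) a
  objective-value 1≤p zero = begin
    r * (x * y) + u * (s - x * y)
      ≡⟨ solve 5 (λ r u x y s → r :* (x :* y) :+ u :* (s :- x :* y)
           := u :* s :+ con 0ℚ :+ (x :* r :+ u :- (con 1ℚ :+ x) :* u) :* y) refl r u x y s ⟩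
    u * s + 0ℚ + (x * r + u - (1ℚ + x) * u) * y
      ≡⟨ cong₂ (λ b c → u * s + 0ℚ + (b + u - c) * y) (1/ℕ-inverse-≥1 1≤p)
           (trans (cong (_* u) (sym (ℕ→ℚ-suc p))) (1/ℕ-inverse p)) ⟩
    u * s + 0ℚ + (1ℚ + u - 1ℚ) * y
      ≡⟨ cong (λ z → u * s + 0ℚ + z * y) (solve 1 (λ u → con 1ℚ :+ u :- con 1ℚ := u) refl u) ⟩
    u * s + 0ℚ + u * y
      ≡⟨ cong₂ (λ b c → u * s + b + 1/ℕ c * y)
           (sym (∑-empty {p ℕ.+ 1} {p} (λ i → 1/ℕ (i ℕ.* (i ℕ.+ 1)) * ∑ 1 i (weighted (a i)))
             (ℕP.≤-reflexive (ℕP.+-comm 1 p))))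
           (ℕP.+-comm 1 p) ⟩
    u * s + middle 0 + 1/ℕ (p ℕ.+ 1) * y ∎
    where
    open ≡-Reasoning
    r = 1/ℕ p
    u = 1/ℕ (suc p)
    x = ℕ→ℚ p
    y = a p p
    s = load p a 1
  objective-value 1≤p (suc n) = begin
    value p (load p a) (suc n) + v * (s₂ - s₁)
      ≡⟨ cong (_+ v * (s₂ - s₁)) (objective-value 1≤p n) ⟩
    u * s₁ + middle n + c + v * (s₂ - s₁)
      ≡⟨ solve 6 (λ u v s₁ s₂ m c → u :* s₁ :+ m :+ c :+ v :* (s₂ :- s₁)
           := v :* s₂ :+ (m :+ (u :- v) :* s₁) :+ c) refl u v s₁ s₂ (middle n) c ⟩
    v * s₂ + (middle n + (u - v) * s₁) + c
      ≡⟨ cong (λ z → v * s₂ + z + c) (middle-suc n) ⟨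
    v * s₂ + middle (suc n) + c ∎
    where
    open ≡-Reasoning
    u = 1/ℕ (suc (n ℕ.+ p))
    v = 1/ℕ (suc (suc (n ℕ.+ p)))
    s₁ = load p a (suc n)
    s₂ = load p a (suc (suc n))
    c = 1/ℕ (p ℕ.+ 1) * a p p

row-pair : ∀ n {τ R x σ} → 0ℚ ≤ x → τ ≤ ℕ→ℚ n * R → R + x ≤ 1ℚ →
  σ - τ - ℕ→ℚ (n ∸ 1) * x ≤ 0ℚ → 1 ℕ.≤ n →
  τ + ℕ→ℚ (suc n) * x + σ ≤ (ℕ→ℚ 2 * ℕ→ℚ n + 0ℚ) * 1ℚ
row-pair (suc n) {τ} {R} {x} {σ} 0≤x τ≤ R+x≤1 flow _ = begin
  τ + ℕ→ℚ (2 ℕ.+ n) * x + σ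
    ≡⟨ cong (λ z → τ + z * x + σ) (ℕ→ℚ-+ 2 n) ⟩
  τ + (ℕ→ℚ 2 + y) * x + σ
    ≡⟨ solve 4 (λ τ x σ y → τ :+ (con (ℕ→ℚ 2) :+ y) :* x :+ σ
         := con (ℕ→ℚ 2) :* (τ :+ (con 1ℚ :+ y) :* x) :+ (σ :- τ :- y :* x)) refl τ x σ y ⟩
  ℕ→ℚ 2 * (τ + (1ℚ + y) * x) + (σ - τ - y * x)
    ≤⟨ +-mono-≤ (*-monoˡ (ℕ→ℚ-nonneg 2) (+-monoˡ-≤ ((1ℚ + y) * x) τ≤)) flow ⟩
  ℕ→ℚ 2 * (N * R + (1ℚ + y) * x) + 0ℚ
    ≡⟨ cong (λ z → ℕ→ℚ 2 * (N * R + z * x) + 0ℚ) (ℕ→ℚ-suc n) ⟨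
  ℕ→ℚ 2 * (N * R + N * x) + 0ℚ
    ≡⟨ solve 3 (λ N R x → con (ℕ→ℚ 2) :* (N :* R :+ N :* x) :+ con 0ℚ := con (ℕ→ℚ 2) :* (N :* (R :+ x)))
         refl N R x ⟩
  ℕ→ℚ 2 * (N * (R + x))
    ≤⟨ *-monoˡ (ℕ→ℚ-nonneg 2) (*-monoˡ (ℕ→ℚ-nonneg (suc n)) R+x≤1) ⟩
  ℕ→ℚ 2 * (N * 1ℚ)
    ≡⟨ solve 1 (λ N → con (ℕ→ℚ 2) :* (N :* con 1ℚ) := (con (ℕ→ℚ 2) :* N :+ con 0ℚ) :* con 1ℚ) refl N ⟩
  (ℕ→ℚ 2 * N + 0ℚ) * 1ℚ ∎
  where
  open ≤-Reasoning
  y = ℕ→ℚ n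
  N = ℕ→ℚ (suc n)

module _ {p k : ℕ} {a : Matrix} (1≤p : 1 ℕ.≤ p) (F : Feasible p k a) where
  open Feasible F

  load≤row : ∀ n → n ℕ.+ p ℕ.≤ k → load p a n ≤ ∑ 1 (n ℕ.+ p) (weighted (a (n ℕ.+ p)))
  load≤row (suc n) _   = ≤-refl
  load≤row zero    p≤k = base-load 1≤p ℕP.≤-refl
    where
    base-load : ∀ {p′} → 1 ℕ.≤ p′ → p′ ℕ.≤ p → ℕ→ℚ p′ * a p p′ ≤ ∑ 1 p′ (weighted (a p))
    base-load {suc p′} _ p′<p = begin
      weighted (a p) (suc p′)       ≡⟨ +-identityˡ _ ⟨
      0ℚ + weighted (a p) (suc p′)
        ≤⟨ +-monoˡ-≤ (weighted (a p) (suc p′)) (∑-nonneg p′ (weighted (a p))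
             (λ j 1≤j j≤p′ → *-nonneg (ℕ→ℚ-nonneg j)
               (nonneg p j ℕP.≤-refl p≤k 1≤j (ℕP.≤-trans j≤p′ (ℕP.≤-trans (ℕP.n≤1+n p′) p′<p))))) ⟩
      ∑ 1 p′ (weighted (a p)) + weighted (a p) (suc p′) ≡⟨ ∑₁-suc p′ (weighted (a p)) ⟨
      ∑ 1 (suc p′) (weighted (a p)) ∎
      where open ≤-Reasoning

  feasible-profile : ∀ n → n ℕ.+ p ℕ.≤ k → Profile p 0ℚ 1ℚ n (load p a n) (value p (load p a) n)
  feasible-profile zero    _   = start (*-monoˡ (ℕ→ℚ-nonneg p) base)
  feasible-profile (suc n) i≤k = step (feasible-profile n (ℕP.≤-trans (ℕP.n≤1+n _) i≤k)) row pair
    where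
    m = n ℕ.+ p
    i = suc m
    p+1≤i : p ℕ.+ 1 ℕ.≤ i
    p+1≤i = subst (ℕ._≤ i) (ℕP.+-comm 1 p) (s≤s (ℕP.m≤n+m p n))
    0≤a : ∀ j → 1 ℕ.≤ j → j ℕ.≤ i → 0ℚ ≤ a i j
    0≤a j = nonneg i j (ℕP.≤-trans (ℕP.m≤n+m p n) (ℕP.n≤1+n m)) i≤k
    row : load p a (suc n) ≤ ℕ→ℚ i * 1ℚ
    row = ≤-trans (∑-weighted≤ i (a i) 0≤a)
      (*-monoˡ (ℕ→ℚ-nonneg i) (row-sum i p+1≤i i≤k))
    pair : load p a (suc n) + load p a n ≤ (ℕ→ℚ 2 * ℕ→ℚ m + 0ℚ) * 1ℚ
    pair = ≤-trans
      (+-mono-≤ (≤-reflexive (∑₁-suc m (weighted (a i)))) (load≤row n (ℕP.≤-trans (ℕP.n≤1+n m) i≤k)))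
      (row-pair m (0≤a i (s≤s z≤n) ℕP.≤-refl)
        (∑-weighted≤ m (a i) (λ j 1≤j j≤m → 0≤a j 1≤j (ℕP.m≤n⇒m≤1+n j≤m)))
        (subst (_≤ 1ℚ) (∑₁-suc m (a i)) (row-sum i p+1≤i i≤k))
        (flow i p+1≤i i≤k)
        (ℕP.≤-trans 1≤p (ℕP.m≤n+m p n)))

profile-bound : ∀ {p e M} → 1 ℕ.≤ p → 0ℚ ≤ e → 0ℚ ≤ M → ∀ n {s v} → Profile p e M n s v →
  v ≤ (ρ p (n ℕ.+ p) + ℕ→ℚ (suc n) * e) * M
profile-bound {p} {e} {M} 1≤p 0≤e 0≤M n {v = v} P with even⊎odd n
... | q , inj₁ refl = begin
  v                                                  ≤⟨ even-bound 1≤p 0≤e 0≤M q P ⟩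
  (1ℚ + pairSum p q + ℕ→ℚ q * e) * M                 ≤⟨ *-monoʳ-≤-nonNeg M {{nonNegative 0≤M}}
      (+-mono-≤ (≤-reflexive (sym (ρ-even p q))) (*-monoʳ-≤-nonNeg e {{nonNegative 0≤e}}
        (ℕ→ℚ-mono (ℕP.m≤n⇒m≤1+n (ℕP.m≤m*n q 2))))) ⟩
  (ρ p (q ℕ.* 2 ℕ.+ p) + ℕ→ℚ (suc (q ℕ.* 2)) * e) * M ∎
  where open ≤-Reasoning
... | q , inj₂ refl = begin
  v                                                  ≤⟨ odd-bound 1≤p 0≤e 0≤M q P ⟩
  (1ℚ + 1/ℕ (suc i) - 1/ℕ i * 1/ℕ (suc i) + pairSum p q + ℕ→ℚ (suc q) * e) * M
    ≤⟨ *-monoʳ-≤-nonNeg M {{nonNegative 0≤M}}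
      (+-mono-≤ (≤-reflexive (sym (ρ-odd p q 1≤p))) (*-monoʳ-≤-nonNeg e {{nonNegative 0≤e}}
        (ℕ→ℚ-mono (s≤s (ℕP.m≤n⇒m≤1+n (ℕP.m≤m*n q 2)))))) ⟩
  (ρ p (suc i) + ℕ→ℚ (suc (suc (q ℕ.* 2))) * e) * M ∎
  where open ≤-Reasoning
        i = q ℕ.* 2 ℕ.+ p

objective≤ρ : ∀ {p a} n → 1 ℕ.≤ p → Feasible p (suc n ℕ.+ p) a → objective p (suc n ℕ.+ p) a ≤ ρ p (suc n ℕ.+ p)
objective≤ρ {p} {a} n 1≤p F = begin
  objective p k a                                 ≡⟨ objective-value p a 1≤p n ⟨
  value p (load p a) (suc n)                      ≤⟨ profile-bound 1≤p ≤-refl (ℕ→ℚ-nonneg 1) (suc n)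
                                                       (feasible-profile 1≤p F (suc n) ℕP.≤-refl) ⟩
  (ρ p k + ℕ→ℚ (2 ℕ.+ n) * 0ℚ) * 1ℚ               ≡⟨ solve 2 (λ x y → (x :+ y :* con 0ℚ) :* con 1ℚ := x) refl
                                                       (ρ p k) (ℕ→ℚ (2 ℕ.+ n)) ⟩
  ρ p k                                           ∎
  where open ≤-Reasoning
        k = suc n ℕ.+ p

∑-zero : ∀ n f → (∀ j → 1 ℕ.≤ j → j ℕ.≤ n → f j ≡ 0ℚ) → ∑ 1 n f ≡ 0ℚ
∑-zero zero    f f≡0 = refl
∑-zero (suc n) f f≡0 = trans (∑₁-suc n f) (cong₂ _+_
  (∑-zero n f (λ j 1≤j j≤n → f≡0 j 1≤j (ℕP.m≤n⇒m≤1+n j≤n)))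
  (f≡0 (suc n) (s≤s z≤n) ℕP.≤-refl))

∑-single : ∀ n f c → 1 ℕ.≤ c → c ℕ.≤ n → (∀ j → j ≢ c → f j ≡ 0ℚ) → ∑ 1 n f ≡ f c
∑-single zero    f (suc c) _ () _
∑-single (suc n) f c 1≤c c≤1+n f≡0 = trans (∑₁-suc n f) (helper (c ℕ.≟ suc n))
  where
  helper : Dec (c ≡ suc n) → ∑ 1 n f + f (suc n) ≡ f c
  helper (yes refl) = trans
    (cong (_+ f (suc n)) (∑-zero n f (λ j _ j≤n → f≡0 j (ℕP.<⇒≢ (s≤s j≤n)))))
    (+-identityˡ (f (suc n)))
  helper (no c≢)    = trans
    (cong₂ _+_ (∑-single n f c 1≤c (ℕP.≤-pred (ℕP.≤∧≢⇒< c≤1+n c≢)) f≡0) (f≡0 (suc n) (λ eq → c≢ (sym eq))))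
    (+-identityʳ (f c))

Single : (ℕ → ℚ) → ℚ → ℕ → Set
Single f x c = f c ≡ x × (∀ j → j ≢ c → f j ≡ 0ℚ)

module _ (f : ℕ → ℚ) {c : ℕ} {x : ℚ} (R : Single f x c) where

  weighted-zero : ∀ j → j ≢ c → weighted f j ≡ 0ℚ
  weighted-zero j j≢c = trans (cong (ℕ→ℚ j *_) (proj₂ R j j≢c)) (*-zeroʳ (ℕ→ℚ j))

  single-weighted : ∀ n → c ℕ.≤ n → ∑ 1 n (weighted f) ≡ ℕ→ℚ c * x
  single-weighted n c≤n = trans (helper (1 ℕ.≤? c)) (cong (ℕ→ℚ c *_) (proj₁ R))
    where
    helper : Dec (1 ℕ.≤ c) → ∑ 1 n (weighted f) ≡ weighted f c
    helper (yes 1≤c) = ∑-single n (weighted f) c 1≤c c≤n weighted-zero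
    helper (no  1≰c) = trans
      (∑-zero n (weighted f) (λ j 1≤j _ → weighted-zero j (λ { refl → 1≰c 1≤j })))
      (sym (trans (cong (λ z → ℕ→ℚ z * f c) (ℕP.n<1⇒n≡0 (ℕP.≰⇒> 1≰c))) (*-zeroˡ (f c))))

  single-weighted-zero : ∀ n → n ℕ.< c → ∑ 1 n (weighted f) ≡ 0ℚ
  single-weighted-zero n n<c = ∑-zero n (weighted f)
    (λ j _ j≤n → weighted-zero j (ℕP.<⇒≢ (ℕP.≤-<-trans j≤n n<c)))

  single-total : ∀ n → 1 ℕ.≤ c → c ℕ.≤ n → ∑ 1 n f ≡ x
  single-total n 1≤c c≤n = trans (∑-single n f c 1≤c c≤n (proj₂ R)) (proj₁ R)

single-weighted-one : ∀ f {c} → Single f 1ℚ c → ∀ n → c ℕ.≤ n → ∑ 1 n (weighted f) ≡ ℕ→ℚ c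
single-weighted-one f {c} R n c≤n = trans (single-weighted f R n c≤n) (*-identityʳ (ℕ→ℚ c))

-- All units of row m can be absorbed by row m + 1, whose single one sits
-- either on the diagonal or next to it.
Absorbs : Matrix → ℕ → Set
Absorbs a m =
  (Single (a (suc m)) 1ℚ (suc m) × ∑ 1 m (weighted (a m)) ≤ ℕ→ℚ (m ∸ 1)) ⊎
  (Single (a (suc m)) 1ℚ m × ∑ 1 m (weighted (a m)) ≤ ℕ→ℚ m)

absorbs⇒flow : ∀ {a} m → Absorbs a m →
  ∑ 1 m (weighted (a m)) - ∑ 1 m (weighted (a (suc m))) - ℕ→ℚ (m ∸ 1) * a (suc m) (suc m) ≤ 0ℚ
absorbs⇒flow {a} m (inj₁ (R , σ≤)) = begin
  σ - ∑ 1 m (weighted (a (suc m))) - y * a (suc m) (suc m)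
    ≡⟨ cong₂ (λ b c → σ - b - y * c) (single-weighted-zero (a (suc m)) R m ℕP.≤-refl) (proj₁ R) ⟩
  σ - 0ℚ - y * 1ℚ
    ≡⟨ solve 2 (λ σ y → σ :- con 0ℚ :- y :* con 1ℚ := σ :- y) refl σ y ⟩
  σ - y ≤⟨ +-monoˡ-≤ (- y) σ≤ ⟩
  y - y ≡⟨ +-inverseʳ y ⟩
  0ℚ    ∎
  where open ≤-Reasoning
        y = ℕ→ℚ (m ∸ 1)
        σ = ∑ 1 m (weighted (a m))
absorbs⇒flow {a} m (inj₂ (R , σ≤)) = begin
  σ - ∑ 1 m (weighted (a (suc m))) - y * a (suc m) (suc m)
    ≡⟨ cong₂ (λ b c → σ - b - y * c) (single-weighted-one (a (suc m)) R m ℕP.≤-refl) (proj₂ R (suc m) ℕP.1+n≢n) ⟩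
  σ - N - y * 0ℚ
    ≡⟨ solve 3 (λ σ N y → σ :- N :- y :* con 0ℚ := σ :- N) refl σ N y ⟩
  σ - N ≤⟨ +-monoˡ-≤ (- N) σ≤ ⟩
  N - N ≡⟨ +-inverseʳ N ⟩
  0ℚ    ∎
  where open ≤-Reasoning
        y = ℕ→ℚ (m ∸ 1)
        N = ℕ→ℚ m
        σ = ∑ 1 m (weighted (a m))

absorbing⇒feasible : ∀ {p k} a → 1 ℕ.≤ p → (∀ i j → 0ℚ ≤ a i j) → a p p ≤ 1ℚ →
  (∀ n → suc (n ℕ.+ p) ℕ.≤ k → Absorbs a (n ℕ.+ p)) → Feasible p k a
absorbing⇒feasible {p} {k} a 1≤p 0≤a a≤1 absorbs = record
  { row-sum = λ i p<i i≤k → total i p<i (at i p<i i≤k)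
  ; base    = a≤1
  ; flow    = λ { zero p<i _ → ⊥-elim (ℕP.<⇒≱ (subst (0 ℕ.<_) (ℕP.+-comm 1 p) (s≤s z≤n)) p<i)
                ; (suc m) p<i i≤k → absorbs⇒flow {a} m (at (suc m) p<i i≤k) }
  ; nonneg  = λ i j _ _ _ _ → 0≤a i j
  }
  where
  at : ∀ i → p ℕ.+ 1 ℕ.≤ i → i ℕ.≤ k → Absorbs a (i ∸ 1)
  at i p<i i≤k = subst (Absorbs a) n+p≡
    (absorbs (i ∸ 1 ∸ p) (subst (ℕ._≤ k) (trans (sym i≡) (cong suc (sym n+p≡))) i≤k))
    where
    p<i′ : suc p ℕ.≤ i
    p<i′ = subst (ℕ._≤ i) (ℕP.+-comm p 1) p<i
    i≡ : suc (i ∸ 1) ≡ i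
    i≡ = ℕP.m+[n∸m]≡n (ℕP.≤-trans (s≤s z≤n) p<i′)
    n+p≡ : i ∸ 1 ∸ p ℕ.+ p ≡ i ∸ 1
    n+p≡ = ℕP.m∸n+n≡m (ℕP.≤-pred (subst (suc p ℕ.≤_) (sym i≡) p<i′))
  total : ∀ i → p ℕ.+ 1 ℕ.≤ i → Absorbs a (i ∸ 1) → ∑ 1 i (a i) ≤ 1ℚ
  total zero    p<i _               = ⊥-elim (ℕP.<⇒≱ (subst (0 ℕ.<_) (ℕP.+-comm 1 p) (s≤s z≤n)) p<i)
  total (suc m) p<i (inj₁ (R , _)) = ≤-reflexive (single-total (a (suc m)) R (suc m) (s≤s z≤n) ℕP.≤-refl)
  total (suc m) p<i (inj₂ (R , _)) = ≤-reflexive (single-total (a (suc m)) R (suc m)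
    (ℕP.≤-trans 1≤p (ℕP.≤-pred (subst (ℕ._≤ suc m) (ℕP.+-comm p 1) p<i))) (ℕP.n≤1+n m))

module _ {p : ℕ} (s : ℕ → ℚ) (1≤p : 1 ℕ.≤ p) where

  value-even : ∀ q →
    (∀ t → t ℕ.< q → s (t ℕ.* 2) ≡ ℕ→ℚ (t ℕ.* 2 ℕ.+ p) × s (suc (t ℕ.* 2)) ≡ ℕ→ℚ (t ℕ.* 2 ℕ.+ p)) →
    value p s (q ℕ.* 2) ≡ 1/ℕ (q ℕ.* 2 ℕ.+ p) * s (q ℕ.* 2) + pairSum p q
  value-even zero    _     = sym (+-identityʳ (1/ℕ p * s 0))
  value-even (suc q) steps = begin
    value p s (q ℕ.* 2) + u * (s₁ - s₀) + v * (s₂ - s₁)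
      ≡⟨ cong (λ z → z + u * (s₁ - s₀) + v * (s₂ - s₁))
           (value-even q (λ t t<q → steps t (ℕP.m≤n⇒m≤1+n t<q))) ⟩
    r * s₀ + S + u * (s₁ - s₀) + v * (s₂ - s₁)
      ≡⟨ cong₂ (λ b c → r * b + S + u * (c - b) + v * (s₂ - c))
           (proj₁ (steps q ℕP.≤-refl)) (proj₂ (steps q ℕP.≤-refl)) ⟩
    r * x + S + u * (x - x) + v * (s₂ - x)
      ≡⟨ solve 6 (λ r x S u v s₂ → r :* x :+ S :+ u :* (x :- x) :+ v :* (s₂ :- x)
           := v :* s₂ :+ (S :+ con (ℕ→ℚ 2) :* v) :+ (x :* r :- (con (ℕ→ℚ 2) :+ x) :* v)) refl r x S u v s₂ ⟩
    v * s₂ + (S + ℕ→ℚ 2 * v) + (x * r - (ℕ→ℚ 2 + x) * v)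
      ≡⟨ cong₂ (λ b c → v * s₂ + (S + ℕ→ℚ 2 * v) + (b - c)) (1/ℕ-inverse-≥1 (ℕP.≤-trans 1≤p (ℕP.m≤n+m p (q ℕ.* 2))))
           (trans (cong (_* v) (sym (ℕ→ℚ-+ 2 i))) (1/ℕ-inverse (suc i))) ⟩
    v * s₂ + (S + ℕ→ℚ 2 * v) + (1ℚ - 1ℚ)
      ≡⟨ +-identityʳ (v * s₂ + (S + ℕ→ℚ 2 * v)) ⟩
    v * s₂ + (S + ℕ→ℚ 2 * v) ∎
    where
    open ≡-Reasoning
    i = q ℕ.* 2 ℕ.+ p
    r = 1/ℕ i
    u = 1/ℕ (suc i)
    v = 1/ℕ (suc (suc i))
    S = pairSum p q
    x = ℕ→ℚ i
    s₀ = s (q ℕ.* 2)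
    s₁ = s (suc (q ℕ.* 2))
    s₂ = s (suc (suc (q ℕ.* 2)))

  value-top-even : ∀ q →
    (∀ t → t ℕ.< q → s (t ℕ.* 2) ≡ ℕ→ℚ (t ℕ.* 2 ℕ.+ p) × s (suc (t ℕ.* 2)) ≡ ℕ→ℚ (t ℕ.* 2 ℕ.+ p)) →
    s (q ℕ.* 2) ≡ ℕ→ℚ (q ℕ.* 2 ℕ.+ p) → value p s (q ℕ.* 2) ≡ ρ p (q ℕ.* 2 ℕ.+ p)
  value-top-even q steps top = begin
    value p s (q ℕ.* 2)           ≡⟨ value-even q steps ⟩
    1/ℕ i * s (q ℕ.* 2) + S       ≡⟨ cong (λ z → 1/ℕ i * z + S) top ⟩
    1/ℕ i * ℕ→ℚ i + S             ≡⟨ cong (_+ S) (trans (*-comm (1/ℕ i) (ℕ→ℚ i)) (1/ℕ-inverse-≥1 (ℕP.≤-trans 1≤p (ℕP.m≤n+m p (q ℕ.* 2))))) ⟩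
    1ℚ + S                        ≡⟨ ρ-even p q ⟨
    ρ p i                         ∎
    where
    open ≡-Reasoning
    i = q ℕ.* 2 ℕ.+ p
    S = pairSum p q

  value-top-odd : ∀ q →
    (∀ t → t ℕ.< q → s (t ℕ.* 2) ≡ ℕ→ℚ (t ℕ.* 2 ℕ.+ p) × s (suc (t ℕ.* 2)) ≡ ℕ→ℚ (t ℕ.* 2 ℕ.+ p)) →
    s (q ℕ.* 2) ≡ ℕ→ℚ (q ℕ.* 2 ℕ.+ p ∸ 1) → s (suc (q ℕ.* 2)) ≡ ℕ→ℚ (suc (q ℕ.* 2 ℕ.+ p)) →
    value p s (suc (q ℕ.* 2)) ≡ ρ p (suc (q ℕ.* 2 ℕ.+ p))
  value-top-odd q steps below top = begin
    value p s (q ℕ.* 2) + u * (s (suc (q ℕ.* 2)) - s (q ℕ.* 2))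
      ≡⟨ cong (_+ u * (s (suc (q ℕ.* 2)) - s (q ℕ.* 2))) (value-even q steps) ⟩
    1/ℕ i * s (q ℕ.* 2) + S + u * (s (suc (q ℕ.* 2)) - s (q ℕ.* 2))
      ≡⟨ cong₂ (λ b c → 1/ℕ i * b + S + u * (c - b)) below top ⟩
    1/ℕ i * ℕ→ℚ (i ∸ 1) + S + u * (ℕ→ℚ (suc i) - ℕ→ℚ (i ∸ 1))
      ≡⟨ tops (ℕP.≤-trans 1≤p (ℕP.m≤n+m p (q ℕ.* 2))) ⟩
    1ℚ + u - 1/ℕ i * u + S
      ≡⟨ ρ-odd p q 1≤p ⟨
    ρ p (suc i) ∎
    where
    open ≡-Reasoning
    i = q ℕ.* 2 ℕ.+ p
    u = 1/ℕ (suc i)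
    S = pairSum p q
    tops : ∀ {i} → 1 ℕ.≤ i → 1/ℕ i * ℕ→ℚ (i ∸ 1) + S + 1/ℕ (suc i) * (ℕ→ℚ (suc i) - ℕ→ℚ (i ∸ 1))
                             ≡ 1ℚ + 1/ℕ (suc i) - 1/ℕ i * 1/ℕ (suc i) + S
    tops {suc j} _ = begin
      r * y + S + w * (ℕ→ℚ (2 ℕ.+ j) - y)
        ≡⟨ cong (λ z → r * y + S + w * (z - y)) (ℕ→ℚ-+ 2 j) ⟩
      r * y + S + w * (ℕ→ℚ 2 + y - y)
        ≡⟨ solve 4 (λ r y w S → r :* y :+ S :+ w :* (con (ℕ→ℚ 2) :+ y :- y)
             := (con 1ℚ :+ y) :* r :+ w :- (r :- w) :+ S) refl r y w S ⟩
      (1ℚ + y) * r + w - (r - w) + S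
        ≡⟨ cong₂ (λ b c → b + w - c + S) (trans (cong (_* r) (sym (ℕ→ℚ-suc j))) (1/ℕ-inverse j)) (1/ℕ-telescope j) ⟩
      1ℚ + w - r * w + S ∎
      where
      y = ℕ→ℚ j
      r = 1/ℕ (suc j)
      w = 1/ℕ (suc (suc j))

_∈?ₚ_ : (x : ℕ × ℕ) (l : List (ℕ × ℕ)) → Dec (x ∈ l)
x ∈?ₚ l = mem? (≡-dec ℕ._≟_ ℕ._≟_) x l

choose-true : ∀ {A : Set} (A? : Dec A) {x y : ℚ} → A → (if does A? then x else y) ≡ x
choose-true A? {x} {y} a = cong (λ b → if b then x else y) (dec-true A? a)

choose-false : ∀ {A : Set} (A? : Dec A) {x y : ℚ} → ¬ A → (if does A? then x else y) ≡ y
choose-false A? {x} {y} ¬a = cong (λ b → if b then x else y) (dec-false A? ¬a)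

if-nonneg : ∀ b {x y} → 0ℚ ≤ x → 0ℚ ≤ y → 0ℚ ≤ (if b then x else y)
if-nonneg true  0≤x _   = 0≤x
if-nonneg false _   0≤y = 0≤y

if-≤1 : ∀ b → (if b then 1ℚ else 0ℚ) ≤ 1ℚ
if-≤1 true  = ≤-refl
if-≤1 false = ℕ→ℚ-nonneg 1

block : ℕ → ℕ → List (ℕ × ℕ)
block p j = (p ℕ.+ 2 ℕ.* j ℕ.+ 1 , p ℕ.+ 2 ℕ.* j) ∷ (p ℕ.+ 2 ℕ.* j , p ℕ.+ 2 ℕ.* j) ∷ []

double-+ : ∀ p t → p ℕ.+ 2 ℕ.* t ≡ t ℕ.* 2 ℕ.+ p
double-+ p t = trans (ℕP.+-comm p (2 ℕ.* t)) (cong (ℕ._+ p) (ℕP.*-comm 2 t))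

block-form : ∀ p t → block p t ≡ (suc (t ℕ.* 2 ℕ.+ p) , t ℕ.* 2 ℕ.+ p) ∷ (t ℕ.* 2 ℕ.+ p , t ℕ.* 2 ℕ.+ p) ∷ []
block-form p t = trans
  (cong (λ i → (i ℕ.+ 1 , i) ∷ (i , i) ∷ []) (double-+ p t))
  (cong (λ i → (i , t ℕ.* 2 ℕ.+ p) ∷ (t ℕ.* 2 ℕ.+ p , t ℕ.* 2 ℕ.+ p) ∷ []) (ℕP.+-comm (t ℕ.* 2 ℕ.+ p) 1))

∈-blocks⁺ : ∀ p {q t x} → t ℕ.< q →
  x ∈ (suc (t ℕ.* 2 ℕ.+ p) , t ℕ.* 2 ℕ.+ p) ∷ (t ℕ.* 2 ℕ.+ p , t ℕ.* 2 ℕ.+ p) ∷ [] →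
  x ∈ concatMap (block p) (upTo q)
∈-blocks⁺ p {t = t} {x} t<q x∈ = ∈-concatMap⁺ (block p)
  (lose (∈-upTo⁺ t<q) (subst (x ∈_) (sym (block-form p t)) x∈))

∈-blocks⁻ : ∀ p {q i j} → (i , j) ∈ concatMap (block p) (upTo q) →
  ∃[ t ] t ℕ.< q × j ≡ t ℕ.* 2 ℕ.+ p × (i ≡ suc (t ℕ.* 2 ℕ.+ p) ⊎ i ≡ t ℕ.* 2 ℕ.+ p)
∈-blocks⁻ p {q} {i} {j} ij∈ with find (∈-concatMap⁻ (block p) {upTo q} ij∈)
... | t , t∈ , ij∈block with subst ((i , j) ∈_) (block-form p t) ij∈block
...   | here refl         = t , ∈-upTo⁻ t∈ , refl , inj₁ refl
...   | there (here refl) = t , ∈-upTo⁻ t∈ , refl , inj₂ refl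

double-+-≢ : ∀ p {s t} → s ℕ.* 2 ℕ.+ p ≢ suc (t ℕ.* 2 ℕ.+ p)
double-+-≢ p {s} {t} eq = ℕP.even≢odd s t
  (subst₂ (λ x y → x ≡ suc y) (ℕP.*-comm s 2) (ℕP.*-comm t 2)
    (ℕP.+-cancelʳ-≡ p (s ℕ.* 2) (suc (t ℕ.* 2)) eq))

ones-even : ∀ p q → let k = q ℕ.* 2 ℕ.+ p in
  ones p k ≡ concatMap (block p) (upTo q) ++ (k , k) ∷ []
ones-even p q rewrite ℕP.m+n∸n≡m (q ℕ.* 2) p | ⌊double/2⌋ q | parity-double q = refl

⌊suc-double/2⌋ : ∀ q → ⌊ suc (q ℕ.* 2) /2⌋ ≡ q
⌊suc-double/2⌋ zero    = refl
⌊suc-double/2⌋ (suc q) = cong suc (⌊suc-double/2⌋ q)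

ones-odd : ∀ p q → let i = q ℕ.* 2 ℕ.+ p in
  ones p (suc i) ≡ concatMap (block p) (upTo q) ++ (suc i , suc i) ∷ (i , i ∸ 1) ∷ []
ones-odd p q rewrite ℕP.m+n∸n≡m (suc (q ℕ.* 2)) p | ⌊suc-double/2⌋ q | parity-suc-double q = refl

ones-row : ∀ {p k i c} → (i , c) ∈ ones p k → (∀ j → (i , j) ∈ ones p k → j ≡ c) → Single (closedForm p k i) 1ℚ c
ones-row {p} {k} {i} {c} ic∈ unique =
  choose-true ((i , c) ∈?ₚ ones p k) ic∈ ,
  λ j j≢c → choose-false ((i , j) ∈?ₚ ones p k) (λ ij∈ → j≢c (unique j ij∈))

-- The last entries of the closed form lie in rows numbered at least q * 2 + p.
block-rows : ∀ p q k (l : List (ℕ × ℕ)) → ones p k ≡ concatMap (block p) (upTo q) ++ l →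
  (∀ {i j} → (i , j) ∈ l → q ℕ.* 2 ℕ.+ p ℕ.≤ i) → ∀ t → t ℕ.< q →
  Single (closedForm p k (t ℕ.* 2 ℕ.+ p)) 1ℚ (t ℕ.* 2 ℕ.+ p) ×
  Single (closedForm p k (suc (t ℕ.* 2 ℕ.+ p))) 1ℚ (t ℕ.* 2 ℕ.+ p)
block-rows p q k l ones≡ last t t<q =
  ones-row {p} {k} (member (there (here refl))) unique₀ , ones-row {p} {k} (member (here refl)) unique₁
  where
  i = t ℕ.* 2 ℕ.+ p
  i+1<last : suc i ℕ.< q ℕ.* 2 ℕ.+ p
  i+1<last = ℕP.+-monoˡ-≤ p (ℕP.*-monoˡ-≤ 2 t<q)
  member : ∀ {x} → x ∈ (suc i , i) ∷ (i , i) ∷ [] → x ∈ ones p k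
  member x∈ = subst (_ ∈_) (sym ones≡) (∈-++⁺ˡ (∈-blocks⁺ p t<q x∈))
  split : ∀ {x} → x ∈ ones p k → x ∈ concatMap (block p) (upTo q) ⊎ x ∈ l
  split x∈ = ∈-++⁻ (concatMap (block p) (upTo q)) (subst (_ ∈_) ones≡ x∈)
  unique₀ : ∀ j → (i , j) ∈ ones p k → j ≡ i
  unique₀ j ij∈ with split ij∈
  ... | inj₂ ∈l = ⊥-elim (ℕP.<⇒≱ (ℕP.<-trans (ℕP.n<1+n i) i+1<last) (last ∈l))
  ... | inj₁ ∈b with ∈-blocks⁻ p {q} ∈b
  ...   | s , _ , refl , inj₁ eq = ⊥-elim (double-+-≢ p {t} {s} eq)
  ...   | s , _ , refl , inj₂ eq = sym eq
  unique₁ : ∀ j → (suc i , j) ∈ ones p k → j ≡ i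
  unique₁ j ij∈ with split ij∈
  ... | inj₂ ∈l = ⊥-elim (ℕP.<⇒≱ i+1<last (last ∈l))
  ... | inj₁ ∈b with ∈-blocks⁻ p {q} ∈b
  ...   | s , _ , refl , inj₁ eq = sym (ℕP.suc-injective eq)
  ...   | s , _ , refl , inj₂ eq = ⊥-elim (double-+-≢ p {s} {t} (sym eq))

blocks-below : ∀ p {q i j} → (i , j) ∈ concatMap (block p) (upTo q) → i ℕ.< q ℕ.* 2 ℕ.+ p
blocks-below p {q} ij∈ with ∈-blocks⁻ p {q} ij∈
... | t , t<q , _ , inj₁ refl = ℕP.+-monoˡ-≤ p (ℕP.*-monoˡ-≤ 2 t<q)
... | t , t<q , _ , inj₂ refl = ℕP.<-trans (ℕP.n<1+n _) (ℕP.+-monoˡ-≤ p (ℕP.*-monoˡ-≤ 2 t<q))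

load-row : ∀ {p} a {c} n → Single (a (n ℕ.+ p)) 1ℚ c → c ℕ.≤ n ℕ.+ p → (n ≡ 0 → c ≡ p) → load p a n ≡ ℕ→ℚ c
load-row {p} a zero    R _   c≡p with c≡p refl
... | refl = trans (cong (ℕ→ℚ p *_) (proj₁ R)) (*-identityʳ (ℕ→ℚ p))
load-row {p} a (suc n) R c≤i _   = single-weighted-one (a (suc n ℕ.+ p)) R (suc n ℕ.+ p) c≤i

Attains : ℕ → ℕ → Matrix → Set
Attains p k a = Feasible p k a × objective p k a ≡ ρ p k

closedForm-nonneg : ∀ p k i j → 0ℚ ≤ closedForm p k i j
closedForm-nonneg p k i j = if-nonneg (does ((i , j) ∈?ₚ ones p k)) (ℕ→ℚ-nonneg 1) ≤-refl

double-+-cancel-≤ : ∀ p {s t} → s ℕ.* 2 ℕ.+ p ℕ.≤ t ℕ.* 2 ℕ.+ p → s ℕ.≤ t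
double-+-cancel-≤ p {s} {t} le = ℕP.*-cancelʳ-≤ s t 2 (ℕP.+-cancelʳ-≤ p (s ℕ.* 2) (t ℕ.* 2) le)

double-+-cancel-< : ∀ p {s t} → s ℕ.* 2 ℕ.+ p ℕ.< t ℕ.* 2 ℕ.+ p → s ℕ.< t
double-+-cancel-< p {s} {t} lt = ℕP.*-cancelʳ-< 2 s t (ℕP.+-cancelʳ-< p (s ℕ.* 2) (t ℕ.* 2) lt)

module _ {p q : ℕ} (a : Matrix)
  (diagonal    : ∀ t → t ℕ.< q → Single (a (t ℕ.* 2 ℕ.+ p)) 1ℚ (t ℕ.* 2 ℕ.+ p))
  (subdiagonal : ∀ t → t ℕ.< q → Single (a (suc (t ℕ.* 2 ℕ.+ p))) 1ℚ (t ℕ.* 2 ℕ.+ p))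
  where

  block-loads : ∀ t → t ℕ.< q →
    load p a (t ℕ.* 2) ≡ ℕ→ℚ (t ℕ.* 2 ℕ.+ p) × load p a (suc (t ℕ.* 2)) ≡ ℕ→ℚ (t ℕ.* 2 ℕ.+ p)
  block-loads t t<q =
    load-row a (t ℕ.* 2) (diagonal t t<q) ℕP.≤-refl (cong (ℕ._+ p)) ,
    load-row a (suc (t ℕ.* 2)) (subdiagonal t t<q) (ℕP.n≤1+n _) (λ ())

  absorbs-subdiagonal : ∀ t → t ℕ.< q → Absorbs a (t ℕ.* 2 ℕ.+ p)
  absorbs-subdiagonal t t<q = inj₂ (subdiagonal t t<q ,
    ≤-reflexive (single-weighted-one (a m) (diagonal t t<q) m ℕP.≤-refl))
    where m = t ℕ.* 2 ℕ.+ p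

  absorbs-diagonal : ∀ t → t ℕ.< q → Single (a (suc t ℕ.* 2 ℕ.+ p)) 1ℚ (suc t ℕ.* 2 ℕ.+ p) →
    Absorbs a (suc (t ℕ.* 2 ℕ.+ p))
  absorbs-diagonal t t<q R = inj₁ (R ,
    ≤-reflexive (single-weighted-one (a (suc m)) (subdiagonal t t<q) (suc m) (ℕP.n≤1+n m)))
    where m = t ℕ.* 2 ℕ.+ p

closedForm-even : ∀ p q′ → 1 ℕ.≤ p → let k = suc q′ ℕ.* 2 ℕ.+ p in Attains p k (closedForm p k)
closedForm-even p q′ 1≤p =
  absorbing⇒feasible a 1≤p (closedForm-nonneg p k) (if-≤1 (does ((p , p) ∈?ₚ ones p k))) absorbs ,
  trans (sym (objective-value p a 1≤p (suc (q′ ℕ.* 2))))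
    (value-top-even (load p a) 1≤p q (block-loads a diagonal subdiagonal)
      (load-row a (q ℕ.* 2) top ℕP.≤-refl (λ ())))
  where
  q = suc q′
  k = q ℕ.* 2 ℕ.+ p
  a = closedForm p k
  rows = block-rows p q k ((k , k) ∷ []) (ones-even p q) (λ { (here refl) → ℕP.≤-refl })
  diagonal : ∀ t → t ℕ.< q → Single (a (t ℕ.* 2 ℕ.+ p)) 1ℚ (t ℕ.* 2 ℕ.+ p)
  diagonal t t<q = proj₁ (rows t t<q)
  subdiagonal : ∀ t → t ℕ.< q → Single (a (suc (t ℕ.* 2 ℕ.+ p))) 1ℚ (t ℕ.* 2 ℕ.+ p)
  subdiagonal t t<q = proj₂ (rows t t<q)
  top : Single (a k) 1ℚ k
  top = ones-row {p} {k}
    (subst ((k , k) ∈_) (sym (ones-even p q)) (∈-++⁺ʳ (concatMap (block p) (upTo q)) (here refl)))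
    (λ j kj∈ → unique j (∈-++⁻ (concatMap (block p) (upTo q)) (subst ((k , j) ∈_) (ones-even p q) kj∈)))
    where
    unique : ∀ j → (k , j) ∈ concatMap (block p) (upTo q) ⊎ (k , j) ∈ (k , k) ∷ [] → j ≡ k
    unique j (inj₁ ∈b)        = ⊥-elim (ℕP.<-irrefl refl (blocks-below p {q} ∈b))
    unique j (inj₂ (here eq)) = cong proj₂ eq
  absorbs : ∀ n → suc (n ℕ.+ p) ℕ.≤ k → Absorbs a (n ℕ.+ p)
  absorbs n i≤k with even⊎odd n
  ... | t , inj₁ refl = absorbs-subdiagonal a diagonal subdiagonal t (double-+-cancel-< p {t} {q} i≤k)
  ... | t , inj₂ refl with ℕP.m≤n⇒m<n∨m≡n (double-+-cancel-≤ p {suc t} {q} i≤k)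
  ...   | inj₁ 1+t<q = absorbs-diagonal a diagonal subdiagonal t (ℕP.<-trans (ℕP.n<1+n t) 1+t<q) (diagonal (suc t) 1+t<q)
  ...   | inj₂ refl  = absorbs-diagonal a diagonal subdiagonal t ℕP.≤-refl top

closedForm-odd : ∀ p q → 1 ℕ.≤ p → 1 ℕ.≤ q ⊎ p ≡ 1 →
  let k = suc (q ℕ.* 2 ℕ.+ p) in Attains p k (closedForm p k)
closedForm-odd p q 1≤p wide =
  absorbing⇒feasible a 1≤p (closedForm-nonneg p k) (if-≤1 (does ((p , p) ∈?ₚ ones p k))) absorbs ,
  trans (sym (objective-value p a 1≤p (q ℕ.* 2)))
    (value-top-odd (load p a) 1≤p q (block-loads a diagonal subdiagonal)
      (below-load q refl wide)
      (load-row a (suc (q ℕ.* 2)) top ℕP.≤-refl (λ ())))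
  where
  i = q ℕ.* 2 ℕ.+ p
  k = suc i
  a = closedForm p k
  last = (k , k) ∷ (i , i ∸ 1) ∷ []
  rows = block-rows p q k last (ones-odd p q)
    (λ { (here refl) → ℕP.n≤1+n i ; (there (here refl)) → ℕP.≤-refl })
  diagonal : ∀ t → t ℕ.< q → Single (a (t ℕ.* 2 ℕ.+ p)) 1ℚ (t ℕ.* 2 ℕ.+ p)
  diagonal t t<q = proj₁ (rows t t<q)
  subdiagonal : ∀ t → t ℕ.< q → Single (a (suc (t ℕ.* 2 ℕ.+ p))) 1ℚ (t ℕ.* 2 ℕ.+ p)
  subdiagonal t t<q = proj₂ (rows t t<q)
  split : ∀ {x} → x ∈ ones p k → x ∈ concatMap (block p) (upTo q) ⊎ x ∈ last
  split x∈ = ∈-++⁻ (concatMap (block p) (upTo q)) (subst (_ ∈_) (ones-odd p q) x∈)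
  top : Single (a k) 1ℚ k
  top = ones-row {p} {k}
    (subst ((k , k) ∈_) (sym (ones-odd p q)) (∈-++⁺ʳ (concatMap (block p) (upTo q)) (here refl)))
    (λ j kj∈ → unique j (split kj∈))
    where
    unique : ∀ j → (k , j) ∈ concatMap (block p) (upTo q) ⊎ (k , j) ∈ last → j ≡ k
    unique j (inj₁ ∈b)                = ⊥-elim (ℕP.<⇒≱ (blocks-below p {q} ∈b) (ℕP.n≤1+n i))
    unique j (inj₂ (here eq))         = cong proj₂ eq
    unique j (inj₂ (there (here eq))) = ⊥-elim (ℕP.1+n≢n (cong proj₁ eq))
  below : Single (a i) 1ℚ (i ∸ 1)
  below = ones-row {p} {k}
    (subst ((i , i ∸ 1) ∈_) (sym (ones-odd p q)) (∈-++⁺ʳ (concatMap (block p) (upTo q)) (there (here refl))))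
    (λ j ij∈ → unique j (split ij∈))
    where
    unique : ∀ j → (i , j) ∈ concatMap (block p) (upTo q) ⊎ (i , j) ∈ last → j ≡ i ∸ 1
    unique j (inj₁ ∈b)                = ⊥-elim (ℕP.<-irrefl refl (blocks-below p {q} ∈b))
    unique j (inj₂ (here eq))         = ⊥-elim (ℕP.1+n≢n (sym (cong proj₁ eq)))
    unique j (inj₂ (there (here eq))) = cong proj₂ eq
  below-sum : ∑ 1 i (weighted (a i)) ≡ ℕ→ℚ (i ∸ 1)
  below-sum = single-weighted-one (a i) below i (ℕP.m∸n≤m i 1)
  below-load : ∀ q₀ → q₀ ≡ q → 1 ℕ.≤ q₀ ⊎ p ≡ 1 → load p a (q ℕ.* 2) ≡ ℕ→ℚ (i ∸ 1)
  below-load (suc _) refl _           = below-sum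
  below-load zero    refl (inj₂ refl) = refl
  absorbs : ∀ n → suc (n ℕ.+ p) ℕ.≤ k → Absorbs a (n ℕ.+ p)
  absorbs n i≤k with even⊎odd n
  absorbs n i≤k | t , inj₁ refl with ℕP.m≤n⇒m<n∨m≡n (double-+-cancel-≤ p {t} {q} (ℕP.≤-pred i≤k))
  ... | inj₁ t<q  = absorbs-subdiagonal a diagonal subdiagonal t t<q
  ... | inj₂ refl = inj₁ (top , ≤-reflexive below-sum)
  absorbs n i≤k | t , inj₂ refl with ℕP.m≤n⇒m<n∨m≡n (double-+-cancel-< p {t} {q} (ℕP.≤-pred i≤k))
  ... | inj₁ 1+t<q = absorbs-diagonal a diagonal subdiagonal t (ℕP.<-trans (ℕP.n<1+n t) 1+t<q) (diagonal (suc t) 1+t<q)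
  ... | inj₂ refl  = inj₂ (below , ≤-trans
    (≤-reflexive (single-weighted-one (a (suc m)) (subdiagonal t ℕP.≤-refl) (suc m) (ℕP.n≤1+n m)))
    (ℕ→ℚ-mono (ℕP.n≤1+n m)))
    where m = t ℕ.* 2 ℕ.+ p

narrowForm-attains : ∀ p → 1 ℕ.≤ p → Attains p (suc p) (narrowForm p)
narrowForm-attains p 1≤p =
  absorbing⇒feasible a 1≤p 0≤a a≤1 absorbs ,
  trans (sym (objective-value p a 1≤p 0))
    (value-top-odd (load p a) 1≤p 0 (λ _ ()) p*x≡p-1
      (load-row a 1 top ℕP.≤-refl (λ ())))
  where
  a = narrowForm p
  x = ℕ→ℚ (p ∸ 1) * 1/ℕ p
  T = (p ℕ.+ 1 , p ℕ.+ 1) ∷ []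
  B = (p , p) ∷ []
  ∉T : ∀ {j} → ¬ ((p , j) ∈ T)
  ∉T (here eq) = ℕP.m≢1+m+n p (trans (cong proj₁ eq) (trans (ℕP.+-comm p 1) (cong suc (sym (ℕP.+-identityʳ p)))))
  0≤a : ∀ i j → 0ℚ ≤ a i j
  0≤a i j = if-nonneg (does ((i , j) ∈?ₚ T)) (ℕ→ℚ-nonneg 1) (if-nonneg (does ((i , j) ∈?ₚ B)) (*-nonneg (ℕ→ℚ-nonneg (p ∸ 1)) (1/ℕ-nonneg p)) ≤-refl)
  bottom : Single (a p) x p
  bottom =
    trans (choose-false ((p , p) ∈?ₚ T) ∉T) (choose-true ((p , p) ∈?ₚ B) (here refl)) ,
    λ j j≢p → trans (choose-false ((p , j) ∈?ₚ T) ∉T)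
      (choose-false ((p , j) ∈?ₚ B) (λ { (here eq) → j≢p (cong proj₂ eq) }))
  top : Single (a (suc p)) 1ℚ (suc p)
  top =
    choose-true ((suc p , suc p) ∈?ₚ T) (here (cong₂ _,_ (ℕP.+-comm 1 p) (ℕP.+-comm 1 p))) ,
    λ j j≢ → trans (choose-false ((suc p , j) ∈?ₚ T) (λ { (here eq) → j≢ (trans (cong proj₂ eq) (ℕP.+-comm p 1)) }))
      (choose-false ((suc p , j) ∈?ₚ B) (λ { (here eq) → ℕP.1+n≢n (cong proj₁ eq) }))
  p*x : ∀ {p} → 1 ℕ.≤ p → ℕ→ℚ p * (ℕ→ℚ (p ∸ 1) * 1/ℕ p) ≡ ℕ→ℚ (p ∸ 1)
  p*x {suc m} _ = begin
    ℕ→ℚ (suc m) * (ℕ→ℚ m * 1/ℕ (suc m))   ≡⟨ *-assoc (ℕ→ℚ (suc m)) (ℕ→ℚ m) (1/ℕ (suc m)) ⟨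
    ℕ→ℚ (suc m) * ℕ→ℚ m * 1/ℕ (suc m)     ≡⟨ *-comm (ℕ→ℚ (suc m) * ℕ→ℚ m) (1/ℕ (suc m)) ⟩
    1/ℕ (suc m) * (ℕ→ℚ (suc m) * ℕ→ℚ m)   ≡⟨ cancel-1/ℕ m (ℕ→ℚ m) ⟩
    ℕ→ℚ m                                 ∎
    where open ≡-Reasoning
  p*x≡p-1 : ℕ→ℚ p * a p p ≡ ℕ→ℚ (p ∸ 1)
  p*x≡p-1 = trans (cong (ℕ→ℚ p *_) (proj₁ bottom)) (p*x 1≤p)
  a≤1 : a p p ≤ 1ℚ
  a≤1 = begin
    a p p                  ≡⟨ proj₁ bottom ⟩
    ℕ→ℚ (p ∸ 1) * 1/ℕ p    ≤⟨ *-monoʳ-≤-nonNeg (1/ℕ p) {{nonNegative (1/ℕ-nonneg p)}} (ℕ→ℚ-mono (ℕP.m∸n≤m p 1)) ⟩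
    ℕ→ℚ p * 1/ℕ p          ≡⟨ 1/ℕ-inverse-≥1 1≤p ⟩
    1ℚ                     ∎
    where open ≤-Reasoning
  absorbs : ∀ n → suc (n ℕ.+ p) ℕ.≤ suc p → Absorbs a (n ℕ.+ p)
  absorbs zero    _   = inj₁ (top , ≤-reflexive (trans (single-weighted (a p) bottom p ℕP.≤-refl) (p*x 1≤p)))
  absorbs (suc n) i≤k = ⊥-elim (ℕP.<⇒≱ (s≤s (s≤s (ℕP.m≤n+m p n))) i≤k)

closedForm-attains : ∀ p n → 1 ℕ.≤ p → p ℕ.+ 2 ℕ.≤ suc n ℕ.+ p ⊎ p ≡ 1 →
  Attains p (suc n ℕ.+ p) (closedForm p (suc n ℕ.+ p))
closedForm-attains p n 1≤p wide with even⊎odd n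
... | q , inj₂ refl = closedForm-even p q 1≤p
... | q , inj₁ refl = closedForm-odd p q 1≤p (1≤q wide)
  where
  1≤q : p ℕ.+ 2 ℕ.≤ suc (q ℕ.* 2 ℕ.+ p) ⊎ p ≡ 1 → 1 ℕ.≤ q ⊎ p ≡ 1
  1≤q (inj₂ p≡1) = inj₂ p≡1
  1≤q (inj₁ p+2≤) = inj₁ (double-+-cancel-< p {0} {q} (ℕP.≤-pred (subst (ℕ._≤ suc (q ℕ.* 2 ℕ.+ p)) (ℕP.+-comm p 2) p+2≤)))

attains⇒optimal : ∀ {p a} n → 1 ℕ.≤ p → Attains p (suc n ℕ.+ p) a → IsOptimalSolution p (suc n ℕ.+ p) a
attains⇒optimal n 1≤p (F , eq) = F , λ b Fb → ≤-trans (objective≤ρ n 1≤p Fb) (≤-reflexive (sym eq))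

ρ-optimal : ∀ {p} n → 1 ℕ.≤ p → IsOptimalValue p (suc n ℕ.+ p) (ρ p (suc n ℕ.+ p))
ρ-optimal {p} zero    1≤p = (narrowForm p , narrowForm-attains p 1≤p) , λ b → objective≤ρ 0 1≤p
ρ-optimal {p} (suc n) 1≤p =
  (closedForm p (2 ℕ.+ n ℕ.+ p) , closedForm-attains p (suc n) 1≤p
    (inj₁ (subst (ℕ._≤ 2 ℕ.+ n ℕ.+ p) (ℕP.+-comm 2 p) (s≤s (s≤s (ℕP.m≤n+m p n)))))) ,
  λ b → objective≤ρ (suc n) 1≤p

-- Packings and covers

∣p∩q∣+∣p─q∣≡∣p∣ : ∀ {n} (p q : Subset n) → ∣ p ∩ q ∣ ℕ.+ ∣ p ─ q ∣ ≡ ∣ p ∣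
∣p∩q∣+∣p─q∣≡∣p∣ []            []            = refl
∣p∩q∣+∣p─q∣≡∣p∣ (outside ∷ p) (outside ∷ q) = ∣p∩q∣+∣p─q∣≡∣p∣ p q
∣p∩q∣+∣p─q∣≡∣p∣ (outside ∷ p) (inside  ∷ q) = ∣p∩q∣+∣p─q∣≡∣p∣ p q
∣p∩q∣+∣p─q∣≡∣p∣ (inside  ∷ p) (outside ∷ q) =
  trans (ℕP.+-suc ∣ p ∩ q ∣ ∣ p ─ q ∣) (cong suc (∣p∩q∣+∣p─q∣≡∣p∣ p q))
∣p∩q∣+∣p─q∣≡∣p∣ (inside  ∷ p) (inside  ∷ q) = cong suc (∣p∩q∣+∣p─q∣≡∣p∣ p q)

subset-of-size : ∀ {n} i (p : Subset n) → i ℕ.≤ ∣ p ∣ → ∃[ q ] q ⊆ p × ∣ q ∣ ≡ i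
subset-of-size {n} zero p             _   = ⊥ , ⊥⊆ , ∣⊥∣≡0 n
subset-of-size (suc i) (outside ∷ p) i<  with subset-of-size (suc i) p i<
... | q , q⊆p , eq = outside ∷ q , s⊆s q⊆p , eq
subset-of-size (suc i) (inside  ∷ p) (s≤s i≤) with subset-of-size i p i≤
... | q , q⊆p , eq = inside ∷ q , s⊆s q⊆p , cong suc eq

x∈p─q⇒x∉q : ∀ {n x} (p q : Subset n) → x ∈ₛ p ─ q → x ∉ₛ q
x∈p─q⇒x∉q (inside ∷ p) (outside ∷ q) here         ()
x∈p─q⇒x∉q (s ∷ p)      (t ∷ q)       (there x∈─) (there x∈q) = x∈p─q⇒x∉q p q x∈─ x∈q

0<∣p∣⇒Nonempty : ∀ {n} (p : Subset n) → 0 ℕ.< ∣ p ∣ → Nonempty p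
0<∣p∣⇒Nonempty {n} p 0<∣p∣ with nonempty? p
... | yes ne    = ne
... | no  empty = ⊥-elim (ℕP.<-irrefl (sym (trans (cong ∣_∣ (Empty-unique empty)) (∣⊥∣≡0 n))) 0<∣p∣)

⊆-disjoint⇒⊆─ : ∀ {n} {p q r : Subset n} → p ⊆ q → Disjoint r p → p ⊆ q ─ r
⊆-disjoint⇒⊆─ p⊆q dis x∈p = x∈p∧x∉q⇒x∈p─q (p⊆q x∈p) (λ x∈r → dis (_ , x∈p∩q⁺ (x∈r , x∈p)))

⊆─⇒disjoint : ∀ {n} {p q r s : Subset n} → p ⊆ q ─ r → s ⊆ r → Disjoint s p
⊆─⇒disjoint {p = p} {q} {r} {s} p⊆ s⊆r (x , x∈) with x∈p∩q⁻ s p x∈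
... | x∈s , x∈p = x∈p─q⇒x∉q q r (p⊆ x∈p) (s⊆r x∈s)

∈⇒⊆⋃ : ∀ {n} {S : Subset n} {C} → S ∈ C → S ⊆ ⋃ C
∈⇒⊆⋃ {C = T ∷ C} (here refl) = p⊆p∪q (⋃ C)
∈⇒⊆⋃ {C = T ∷ C} (there S∈C) x∈S = q⊆p∪q T (⋃ C) (∈⇒⊆⋃ S∈C x∈S)

⋃⊆⋃-++ˡ : ∀ {n} (C D : List (Subset n)) → ⋃ C ⊆ ⋃ (C ++ D)
⋃⊆⋃-++ˡ []      D x∈ = ⊥-elim (∉⊥ x∈)
⋃⊆⋃-++ˡ (S ∷ C) D x∈ with x∈p∪q⁻ S (⋃ C) x∈
... | inj₁ x∈S = x∈p∪q⁺ (inj₁ x∈S)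
... | inj₂ x∈⋃ = x∈p∪q⁺ (inj₂ (⋃⊆⋃-++ˡ C D x∈⋃))

⋃⊆⋃-++ʳ : ∀ {n} (C D : List (Subset n)) → ⋃ D ⊆ ⋃ (C ++ D)
⋃⊆⋃-++ʳ []      D x∈ = x∈
⋃⊆⋃-++ʳ (S ∷ C) D x∈ = x∈p∪q⁺ (inj₂ (⋃⊆⋃-++ʳ C D x∈))

∪─-covers : ∀ {n} {p q r : Subset n} → q ⊆ r → p ─ q ⊆ r → p ⊆ r
∪─-covers {q = q} q⊆r p─q⊆r {x} x∈p with x ∈? q
... | yes x∈q = q⊆r x∈q
... | no  x∉q = p─q⊆r (x∈p∧x∉q⇒x∈p─q x∈p x∉q)

module _ {p k : ℕ} (I : Instance p k) where
  open Instance I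

  BoundedBy : ℕ → Subset size → Set
  BoundedBy i U = ∀ S → Available I S → S ⊆ U → ∣ S ∣ ℕ.≤ i

  available-⊆ : ∀ {S T} → S ⊆ T → Available I T → Available I S
  available-⊆ S⊆T (R , R∈ , T⊆R) = R , R∈ , λ x∈S → T⊆R (S⊆T x∈S)

  packing-⊆ : ∀ {i U V C} → U ⊆ V → Packing I i U C → Packing I i V C
  packing-⊆ {i} {U} {V} U⊆V (sets , disjoint) = All.map widen sets , disjoint
    where
    widen : ∀ {S} → IsSetOfSize I i U S → IsSetOfSize I i V S
    widen (av , eq , S⊆U) = av , eq , λ x∈S → U⊆V (S⊆U x∈S)

  packing-size : ∀ {i} U C → Packing I i U C → ∣ U ∣ ≡ i ℕ.* length C ℕ.+ ∣ U ─ ⋃ C ∣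
  packing-size {i} U [] _ =
    trans (cong ∣_∣ (sym (p─⊥≡p U))) (cong (ℕ._+ ∣ U ─ ⊥ ∣) (sym (ℕP.*-zeroʳ i)))
  packing-size {i} U (S ∷ C) ((_ , ∣S∣≡i , S⊆U) ∷ sets , dis ∷ disjoint) = begin
    ∣ U ∣                                              ≡⟨ ∣p∩q∣+∣p─q∣≡∣p∣ U S ⟨
    ∣ U ∩ S ∣ ℕ.+ ∣ U ─ S ∣                            ≡⟨ cong₂ ℕ._+_ (trans (cong ∣_∣ U∩S≡S) ∣S∣≡i)
                                                            (packing-size (U ─ S) C rest) ⟩
    i ℕ.+ (i ℕ.* length C ℕ.+ ∣ U ─ S ─ ⋃ C ∣)         ≡⟨ ℕP.+-assoc i (i ℕ.* length C) _ ⟨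
    i ℕ.+ i ℕ.* length C ℕ.+ ∣ U ─ S ─ ⋃ C ∣           ≡⟨ cong₂ ℕ._+_ (sym (ℕP.*-suc i (length C)))
                                                            (cong ∣_∣ (p─q─r≡p─q∪r U S (⋃ C))) ⟩
    i ℕ.* length (S ∷ C) ℕ.+ ∣ U ─ ⋃ (S ∷ C) ∣         ∎
    where
    open ≡-Reasoning
    U∩S≡S : U ∩ S ≡ S
    U∩S≡S = ⊆-antisym (p∩q⊆q U S) (λ x∈S → x∈p∩q⁺ (S⊆U x∈S , x∈S))
    rest : Packing I i (U ─ S) C
    rest = All.zipWith narrow (sets , dis) , disjoint
      where
      narrow : ∀ {T} → IsSetOfSize I i U T × Disjoint S T → IsSetOfSize I i (U ─ S) T
      narrow ((av , eq , T⊆U) , d) = av , eq , ⊆-disjoint⇒⊆─ T⊆U d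

  -- The members of L that still contribute i elements, once the earlier
  -- members are removed, form the packing.
  cover-packing : ∀ i L U → All (Available I) L → U ⊆ ⋃ L → BoundedBy (suc i) U →
    ∃[ D ] Packing I (suc i) U D × ∣ U ∣ ℕ.≤ i ℕ.* length L ℕ.+ length D × length D ℕ.≤ length L
  cover-packing i [] U _ U⊆ _ = [] , ([] , []) ,
    subst (∣ U ∣ ℕ.≤_) (trans (∣⊥∣≡0 size) (sym (trans (ℕP.+-identityʳ (i ℕ.* 0)) (ℕP.*-zeroʳ i)))) (p⊆q⇒∣p∣≤∣q∣ {q = ⊥} U⊆) , z≤n
  cover-packing i (T ∷ L) U (av ∷ avs) U⊆ bounded
    with cover-packing i L (U ─ T) avs rest (λ S avS S⊆ → bounded S avS (λ x∈S → p─q⊆p U T (S⊆ x∈S)))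
    where
    rest : U ─ T ⊆ ⋃ L
    rest x∈ with x∈p∪q⁻ T (⋃ L) (U⊆ (p─q⊆p U T x∈))
    ... | inj₁ x∈T = ⊥-elim (x∈p─q⇒x∉q U T x∈ x∈T)
    ... | inj₂ x∈L = x∈L
  ... | D , P@(sets , disjoint) , size≤ , D≤L with ∣ U ∩ T ∣ ℕ.≟ suc i
  ...   | yes eq = U ∩ T ∷ D ,
          ((available-⊆ (p∩q⊆q U T) av , eq , p∩q⊆p U T) ∷ proj₁ (packing-⊆ (p─q⊆p U T) P) ,
            All.map separate sets ∷ disjoint) ,
          (begin
            ∣ U ∣                                              ≡⟨ ∣p∩q∣+∣p─q∣≡∣p∣ U T ⟨
            ∣ U ∩ T ∣ ℕ.+ ∣ U ─ T ∣                            ≤⟨ ℕP.+-mono-≤ (ℕP.≤-reflexive eq) size≤ ⟩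
            suc i ℕ.+ (i ℕ.* length L ℕ.+ length D)            ≡⟨ cong suc (trans (sym (ℕP.+-assoc i (i ℕ.* length L) (length D)))
                                                                    (cong (ℕ._+ length D) (sym (ℕP.*-suc i (length L))))) ⟩
            suc (i ℕ.* suc (length L) ℕ.+ length D)            ≡⟨ ℕP.+-suc (i ℕ.* suc (length L)) (length D) ⟨
            i ℕ.* suc (length L) ℕ.+ suc (length D)            ∎) ,
          s≤s D≤L
    where
    open ℕP.≤-Reasoning
    separate : ∀ {S} → IsSetOfSize I (suc i) (U ─ T) S → Disjoint (U ∩ T) S
    separate (_ , _ , S⊆) = ⊆─⇒disjoint S⊆ (p∩q⊆q U T)
  ...   | no neq = D , packing-⊆ (p─q⊆p U T) P ,
          (begin
            ∣ U ∣                                              ≡⟨ ∣p∩q∣+∣p─q∣≡∣p∣ U T ⟨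
            ∣ U ∩ T ∣ ℕ.+ ∣ U ─ T ∣                            ≤⟨ ℕP.+-mono-≤ (ℕP.<⇒≤pred (ℕP.≤∧≢⇒<
                                                                    (bounded (U ∩ T) (available-⊆ (p∩q⊆q U T) av) (p∩q⊆p U T)) neq)) size≤ ⟩
            i ℕ.+ (i ℕ.* length L ℕ.+ length D)                ≡⟨ ℕP.+-assoc i (i ℕ.* length L) (length D) ⟨
            i ℕ.+ i ℕ.* length L ℕ.+ length D                  ≡⟨ cong (ℕ._+ length D) (ℕP.*-suc i (length L)) ⟨
            i ℕ.* suc (length L) ℕ.+ length D                  ∎) ,
          ℕP.m≤n⇒m≤1+n D≤L
    where open ℕP.≤-Reasoning

  maximal-bounded : ∀ {i U C} → Packing I (suc i) U C → Maximal I (suc i) U C → BoundedBy i (U ─ ⋃ C)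
  maximal-bounded {i} {U} {C} (sets , disjoint) maximal S av S⊆ with ∣ S ∣ ℕ.≤? i
  ... | yes ∣S∣≤i = ∣S∣≤i
  ... | no  ∣S∣≰i with subset-of-size (suc i) S (ℕP.≰⇒> ∣S∣≰i)
  ...   | T , T⊆S , ∣T∣≡ = ⊥-elim (x∈p─q⇒x∉q U (⋃ C) (T⊆ x∈T) (∈⇒⊆⋃ T∈C x∈T))
    where
    T⊆ : T ⊆ U ─ ⋃ C
    T⊆ x∈T = S⊆ (T⊆S x∈T)
    T∈C : T ∈ C
    T∈C = maximal (T ∷ C)
      ((available-⊆ T⊆S av , ∣T∣≡ , λ x∈T → p─q⊆p U (⋃ C) (T⊆ x∈T)) ∷ sets ,
       All.tabulate (λ R∈C (x , x∈) → ⊆─⇒disjoint {p = T} {q = U} T⊆ (∈⇒⊆⋃ R∈C)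
         (x , subst (x ∈ₛ_) (∩-comm T _) x∈)) ∷ disjoint)
      there (here refl)
    x∈T : proj₁ (0<∣p∣⇒Nonempty T (subst (0 ℕ.<_) (sym ∣T∣≡) (s≤s z≤n))) ∈ₛ T
    x∈T = proj₂ (0<∣p∣⇒Nonempty T (subst (0 ℕ.<_) (sym ∣T∣≡) (s≤s z≤n)))

  run-covers : ∀ {ε′ i U C} → Run I ε′ i U C → All (Available I) C × U ⊆ ⋃ C
  run-covers (pack {C = C} {D} _ (sets , _) _ _ run) with run-covers run
  ... | avs , U⊆ = AllP.++⁺ (All.map proj₁ sets) avs ,
                   ∪─-covers (⋃⊆⋃-++ˡ C D) (λ x∈ → ⋃⊆⋃-++ʳ C D (U⊆ x∈))
  run-covers (exact {C = C} (sets , _) empty) =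
    All.map proj₁ sets , ∪─-covers {q = ⋃ C} (λ x∈ → x∈) (λ x∈ → ⊥-elim (empty (_ , x∈)))
  run-covers (leftover {U} {C} (sets , _) _ _ av) =
    AllP.++⁺ (All.map proj₁ sets) (av ∷ []) ,
    ∪─-covers (⋃⊆⋃-++ˡ C R) (λ x∈ → ⋃⊆⋃-++ʳ C R (p⊆p∪q ⊥ x∈))
    where R = (U ─ ⋃ C) ∷ []

-- The approximation ratio

ℕ→ℚ-*+ : ∀ i l m → ℕ→ℚ (i ℕ.* l ℕ.+ m) ≡ ℕ→ℚ i * ℕ→ℚ l + ℕ→ℚ m
ℕ→ℚ-*+ i l m = trans (ℕ→ℚ-+ (i ℕ.* l) m) (cong (_+ ℕ→ℚ m) (ℕ→ℚ-* i l))

-- With s and s′ units before and after a phase, l sets of size i + 1 chosen,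
-- d of them possible, and M sets in the optimal cover.
phase-pair : ∀ i {ε′ s s′ l d M} → 0ℚ ≤ ε′ →
  s ≡ ℕ→ℚ (suc i) * l + s′ →
  (ℕ→ℚ 2 - ε′) * 1/ℕ (suc i) * d ≤ l →
  s ≤ ℕ→ℚ i * M + d → d ≤ M →
  s + s′ ≤ (ℕ→ℚ 2 * ℕ→ℚ i + ε′) * M
phase-pair i {ε′} {s} {s′} {l} {d} {M} 0≤ε′ count accurate s≤ d≤M = begin
  s + s′
    ≡⟨ solve 3 (λ s s′ t → s :+ s′ := s :+ (t :+ s′) :- t) refl s s′ (y * l) ⟩
  s + (y * l + s′) - y * l
    ≡⟨ cong (λ z → s + z - y * l) count ⟨
  s + s - y * l
    ≤⟨ +-mono-≤ (+-mono-≤ s≤ s≤) (neg-antimono-≤ (*-monoˡ (ℕ→ℚ-nonneg (suc i)) accurate)) ⟩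
  (x * M + d) + (x * M + d) - y * ((ℕ→ℚ 2 - ε′) * r * d)
    ≡⟨ cong (λ z → (x * M + d) + (x * M + d) - z)
         (trans (solve 4 (λ y r d c → y :* (c :* r :* d) := r :* (y :* (c :* d))) refl y r d (ℕ→ℚ 2 - ε′))
           (cancel-1/ℕ i ((ℕ→ℚ 2 - ε′) * d))) ⟩
  (x * M + d) + (x * M + d) - (ℕ→ℚ 2 - ε′) * d
    ≡⟨ solve 4 (λ x M d e → (x :* M :+ d) :+ (x :* M :+ d) :- (con (ℕ→ℚ 2) :- e) :* d
         := con (ℕ→ℚ 2) :* x :* M :+ e :* d) refl x M d ε′ ⟩
  ℕ→ℚ 2 * x * M + ε′ * d
    ≤⟨ +-monoʳ-≤ (ℕ→ℚ 2 * x * M) (*-monoˡ 0≤ε′ d≤M) ⟩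
  ℕ→ℚ 2 * x * M + ε′ * M
    ≡⟨ *-distribʳ-+ M (ℕ→ℚ 2 * x) ε′ ⟨
  (ℕ→ℚ 2 * x + ε′) * M ∎
  where
  open ≤-Reasoning
  x = ℕ→ℚ i
  y = ℕ→ℚ (suc i)
  r = 1/ℕ (suc i)

exact-cost : ∀ {p u l} → 1 ℕ.≤ p → u ≡ p ℕ.* l ℕ.+ 0 → ℕ→ℚ l ≡ 1/ℕ p * ℕ→ℚ u
exact-cost {suc p} {l = l} _ refl = sym (trans
  (cong (1/ℕ (suc p) *_) (trans (ℕ→ℚ-*+ (suc p) l 0) (+-identityʳ (ℕ→ℚ (suc p) * ℕ→ℚ l))))
  (cancel-1/ℕ p (ℕ→ℚ l)))

start-cost : ∀ {p u l r} → 1 ℕ.≤ p → u ≡ p ℕ.* l ℕ.+ r → ℕ→ℚ l ≤ 1/ℕ p * ℕ→ℚ u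
start-cost {p} {u} {l} {r} 1≤p eq = ≤-trans
  (≤-reflexive (exact-cost {l = l} 1≤p refl))
  (*-monoˡ (1/ℕ-nonneg p) (ℕ→ℚ-mono (subst₂ ℕ._≤_ (sym (ℕP.+-identityʳ (p ℕ.* l))) (sym eq)
    (ℕP.m≤m+n (p ℕ.* l) r))))

module _ {p k : ℕ} (I : Instance p k) (1≤p : 1 ℕ.≤ p) {ε′ : ℚ} (0≤ε′ : 0ℚ ≤ ε′)
         (L : List (Subset (Instance.size I))) (cover : IsCover I L) where
  open Instance I

  M : ℚ
  M = ℕ→ℚ (length L)

  ⊆⋃L : ∀ {U} → U ⊆ ⋃ L
  ⊆⋃L {x = x} _ = subst (λ V → x ∈ₛ V) (sym (proj₂ cover)) ∈⊤

  available-packing : ∀ i U → BoundedBy I (suc i) U →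
    ∃[ D ] Packing I (suc i) U D × ℕ→ℚ ∣ U ∣ ≤ ℕ→ℚ i * M + ℕ→ℚ (length D) × ℕ→ℚ (length D) ≤ M
  available-packing i U bounded =
    let (D , packing , size≤ , D≤L) = cover-packing I i L U (proj₁ cover) ⊆⋃L bounded in
    D , packing ,
    subst (ℕ→ℚ ∣ U ∣ ≤_) (ℕ→ℚ-*+ i (length L) (length D)) (ℕ→ℚ-mono size≤) , ℕ→ℚ-mono D≤L

  bounded-size : ∀ i U → 1 ℕ.≤ i → BoundedBy I i U → ℕ→ℚ ∣ U ∣ ≤ ℕ→ℚ i * M
  bounded-size (suc i) U _ bounded = let (D , _ , size≤ , D≤M) = available-packing i U bounded in begin
    ℕ→ℚ ∣ U ∣                         ≤⟨ size≤ ⟩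
    ℕ→ℚ i * M + ℕ→ℚ (length D)        ≤⟨ +-monoʳ-≤ (ℕ→ℚ i * M) D≤M ⟩
    ℕ→ℚ i * M + M                     ≡⟨ solve 2 (λ x m → x :* m :+ m := (con 1ℚ :+ x) :* m) refl (ℕ→ℚ i) M ⟩
    (1ℚ + ℕ→ℚ i) * M                  ≡⟨ cong (_* M) (ℕ→ℚ-suc i) ⟨
    ℕ→ℚ (suc i) * M                   ∎
    where open ≤-Reasoning

  run-profile : ∀ n {i U C} → BoundedBy I i U → Run I ε′ i U C → i ≡ n ℕ.+ p →
    ∃[ v ] Profile p ε′ M n (ℕ→ℚ ∣ U ∣) v × ℕ→ℚ (length C) ≤ v + 1ℚ
  run-profile zero _ (pack p<p _ _ _ _) refl = ⊥-elim (ℕP.<-irrefl refl p<p)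
  run-profile (suc n) {U = U} bounded (pack {C = C} {D} _ packing maximal accurate run) refl
    = let (v , profile , length≤)       = run-profile n (maximal-bounded I packing maximal) run refl
          (E , packingE , size≤ , E≤M) = available-packing (n ℕ.+ p) U bounded in
    v + r * (ℕ→ℚ ∣ U ∣ - s′) ,
    step profile (bounded-size (suc i) U (s≤s z≤n) bounded)
      (phase-pair i 0≤ε′ count (accurate E packingE) size≤ E≤M) ,
    cost v length≤
    where
    i = n ℕ.+ p
    r = 1/ℕ (suc i)
    s′ = ℕ→ℚ ∣ U ─ ⋃ C ∣
    l = ℕ→ℚ (length C)
    count : ℕ→ℚ ∣ U ∣ ≡ ℕ→ℚ (suc i) * l + s′
    count = trans (cong ℕ→ℚ (packing-size I U C packing)) (ℕ→ℚ-*+ (suc i) (length C) ∣ U ─ ⋃ C ∣)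
    cost : ∀ v → ℕ→ℚ (length D) ≤ v + 1ℚ → ℕ→ℚ (length (C ++ D)) ≤ v + r * (ℕ→ℚ ∣ U ∣ - s′) + 1ℚ
    cost v length≤ = begin
      ℕ→ℚ (length (C ++ D))                      ≡⟨ cong ℕ→ℚ (length-++ C) ⟩
      ℕ→ℚ (length C ℕ.+ length D)                ≡⟨ ℕ→ℚ-+ (length C) (length D) ⟩
      l + ℕ→ℚ (length D)                         ≤⟨ +-monoʳ-≤ l length≤ ⟩
      l + (v + 1ℚ)                               ≡⟨ solve 2 (λ l v → l :+ (v :+ con 1ℚ) := v :+ l :+ con 1ℚ) refl l v ⟩
      v + l + 1ℚ                                 ≡⟨ cong (λ z → v + z + 1ℚ) (cancel-1/ℕ i l) ⟨
      v + r * (ℕ→ℚ (suc i) * l) + 1ℚ             ≡⟨ cong (λ z → v + r * z + 1ℚ)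
                                                      (solve 2 (λ a b → a := a :+ b :- b) refl (ℕ→ℚ (suc i) * l) s′) ⟩
      v + r * (ℕ→ℚ (suc i) * l + s′ - s′) + 1ℚ   ≡⟨ cong (λ z → v + r * (z - s′) + 1ℚ) count ⟨
      v + r * (ℕ→ℚ ∣ U ∣ - s′) + 1ℚ              ∎
      where open ≤-Reasoning
  run-profile (suc n) _ (exact _ _) p≡        = ⊥-elim (ℕP.m≢1+n+m p p≡)
  run-profile (suc n) _ (leftover _ _ _ _) p≡ = ⊥-elim (ℕP.m≢1+n+m p p≡)
  run-profile zero {U = U} bounded (exact {C = C} packing _) _ =
    1/ℕ p * ℕ→ℚ ∣ U ∣ , start (bounded-size p U 1≤p bounded) ,
    ≤-trans (start-cost {l = length C} 1≤p (packing-size I U C packing))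
      (subst (_≤ 1/ℕ p * ℕ→ℚ ∣ U ∣ + 1ℚ) (+-identityʳ (1/ℕ p * ℕ→ℚ ∣ U ∣))
        (+-monoʳ-≤ (1/ℕ p * ℕ→ℚ ∣ U ∣) (ℕ→ℚ-nonneg 1)))
  run-profile zero {U = U} bounded (leftover {C = C} packing _ _ _) _ =
    1/ℕ p * ℕ→ℚ ∣ U ∣ , start (bounded-size p U 1≤p bounded) ,
    subst (_≤ 1/ℕ p * ℕ→ℚ ∣ U ∣ + 1ℚ)
      (sym (trans (cong ℕ→ℚ (length-++ C)) (ℕ→ℚ-+ (length C) 1)))
      (+-monoˡ-≤ 1ℚ (start-cost {l = length C} 1≤p (packing-size I U C packing)))

archimedean : ∀ δ → 0ℚ < δ → ∃[ N ] (∀ m → N ℕ.≤ m → 1ℚ ≤ δ * ℕ→ℚ m)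
archimedean δ@(mkℚ -[1+ _ ] _ _) (*<* ())
archimedean δ@(mkℚ (ℤ.+ zero) _ _) (*<* (ℤ.+<+ ()))
archimedean δ@(mkℚ (ℤ.+ suc a) d c) 0<δ = suc d , λ m N≤m → begin
  1ℚ                            ≡⟨ 1/ℕ-inverse d ⟨
  ℕ→ℚ (suc d) * 1/ℕ (suc d)     ≤⟨ *-monoˡ (ℕ→ℚ-nonneg (suc d)) 1/d≤δ ⟩
  ℕ→ℚ (suc d) * δ               ≡⟨ *-comm (ℕ→ℚ (suc d)) δ ⟩
  δ * ℕ→ℚ (suc d)               ≤⟨ *-monoˡ (<⇒≤ 0<δ) (ℕ→ℚ-mono N≤m) ⟩
  δ * ℕ→ℚ m                     ∎
  where
  open ≤-Reasoning
  1/d≤δ : 1/ℕ (suc d) ≤ δ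
  1/d≤δ = begin
    1/ℕ (suc d)                 ≤⟨ subst (_≤ ℕ→ℚ (suc a) * 1/ℕ (suc d)) (*-identityˡ (1/ℕ (suc d)))
                                     (*-monoʳ-≤-nonNeg (1/ℕ (suc d)) {{nonNegative (1/ℕ-nonneg (suc d))}}
                                       (ℕ→ℚ-mono {1} {suc a} (s≤s z≤n))) ⟩
    ℕ→ℚ (suc a) * 1/ℕ (suc d)   ≡⟨ fromℚᵘ-homo-* (mkℚᵘ (ℤ.+ suc a) 0) (mkℚᵘ (ℤ.+ 1) d) ⟨
    fromℚᵘ (mkℚᵘ (ℤ.+ suc a) 0 ℚᵘ.* mkℚᵘ (ℤ.+ 1) d)
       ≡⟨ fromℚᵘ-cong {mkℚᵘ (ℤ.+ suc a) 0 ℚᵘ.* mkℚᵘ (ℤ.+ 1) d} {toℚᵘ δ}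
            (ℚᵘ.*≡* (cong₂ ℤ._*_ (cong (λ x → ℤ.+ suc x) (ℕP.*-identityʳ a)) (cong (λ x → ℤ.+ suc x) (sym (ℕP.+-identityʳ d))))) ⟩
    fromℚᵘ (toℚᵘ δ)             ≡⟨ fromℚᵘ-toℚᵘ δ ⟩
    δ                           ∎

A1-asymptotic : ∀ p n → 1 ℕ.≤ p → ∀ ε → 0ℚ < ε → ∀ ε′ → 0ℚ < ε′ → ε′ ≤ ε * 1/ℕ (suc n) →
  IsAsymptoticApproximation (A1 p (n ℕ.+ p) ε′) (ρ p (n ℕ.+ p) + ε)
A1-asymptotic p n 1≤p ε 0<ε ε′ 0<ε′ ε′≤ = record
  { covers  = λ I C run → let (avs , ⊤⊆) = run-covers I run in avs , ⊆-antisym ⊆⊤ ⊤⊆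
  ; limsup≤ = λ δ 0<δ → proj₁ (archimedean δ 0<δ) , bound δ 0<δ
  }
  where
  k = n ℕ.+ p
  error≤ε : ℕ→ℚ (suc n) * ε′ ≤ ε
  error≤ε = begin
    ℕ→ℚ (suc n) * ε′                       ≤⟨ *-monoˡ (ℕ→ℚ-nonneg (suc n)) ε′≤ ⟩
    ℕ→ℚ (suc n) * (ε * 1/ℕ (suc n))        ≡⟨ solve 3 (λ x e r → x :* (e :* r) := r :* (x :* e)) refl (ℕ→ℚ (suc n)) ε (1/ℕ (suc n)) ⟩
    1/ℕ (suc n) * (ℕ→ℚ (suc n) * ε)        ≡⟨ cancel-1/ℕ n ε ⟩
    ε                                      ∎
    where open ≤-Reasoning
  bound : ∀ δ 0<δ I C m → A1 p k ε′ I C → IsOPT I m → proj₁ (archimedean δ 0<δ) ℕ.≤ m →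
    ℕ→ℚ (length C) ≤ (ρ p k + ε + δ) * ℕ→ℚ m
  bound δ 0<δ I C _ run ((L , cover , refl) , _) N≤m
    = let (v , profile , length≤) = run-profile I 1≤p (<⇒≤ 0<ε′) L cover n
            (λ { S (T , T∈ , S⊆T) _ → ℕP.≤-trans (p⊆q⇒∣p∣≤∣q∣ S⊆T) (proj₂ (Instance.sizes I T∈)) }) run refl in begin
    ℕ→ℚ (length C)                                   ≤⟨ length≤ ⟩
    v + 1ℚ                                           ≤⟨ +-mono-≤ (profile-bound 1≤p (<⇒≤ 0<ε′) (ℕ→ℚ-nonneg m) n profile)
                                                          (proj₂ (archimedean δ 0<δ) m N≤m) ⟩
    (ρ p k + ℕ→ℚ (suc n) * ε′) * ℕ→ℚ m + δ * ℕ→ℚ m   ≤⟨ +-monoˡ-≤ (δ * ℕ→ℚ m) (*-monoʳ-≤-nonNeg (ℕ→ℚ m)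
                                                          {{nonNegative (ℕ→ℚ-nonneg m)}} (+-monoʳ-≤ (ρ p k) error≤ε)) ⟩
    (ρ p k + ε) * ℕ→ℚ m + δ * ℕ→ℚ m                  ≡⟨ *-distribʳ-+ (ℕ→ℚ m) (ρ p k + ε) δ ⟨
    (ρ p k + ε + δ) * ℕ→ℚ m                          ∎
    where open ≤-Reasoning
          m = length L

theorem2p1 : ∀ (p k : ℕ) → 1 ℕ.≤ p → 2 ℕ.≤ k → p ℕ.< k →
    ((p ℕ.+ 2 ℕ.≤ k ⊎ p ≡ 1 → IsOptimalSolution p k (closedForm p k)) ×
    (k ≡ p ℕ.+ 1 → IsOptimalSolution p k (narrowForm p))) ×
    IsOptimalValue p k (ρ p k) ×
    (∀ ε → 0ℚ < ε →
    ∃[ ε₀ ] 0ℚ < ε₀ ×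
    (∀ ε′ → 0ℚ < ε′ → ε′ ≤ ε₀ →
    IsAsymptoticApproximation (A1 p k ε′) (ρ p k + ε)))
theorem2p1 p k 1≤p 2≤k p<k with ℕP.m≤n⇒∃[o]m+o≡n p<k
... | n , eq with trans (sym eq) (cong suc (ℕP.+-comm p n))
... | refl =
  ((λ wide → attains⇒optimal n 1≤p (closedForm-attains p n 1≤p wide)) , narrow n) ,
  ρ-optimal n 1≤p ,
  λ ε 0<ε → ε * 1/ℕ (2 ℕ.+ n) ,
    positive⁻¹ (ε * 1/ℕ (2 ℕ.+ n)) {{pos*pos⇒pos ε {{positive 0<ε}} (1/ℕ (2 ℕ.+ n)) {{1/ℕ-pos (suc n)}}}} ,
    A1-asymptotic p (suc n) 1≤p ε 0<ε
  where
  narrow : ∀ n → suc n ℕ.+ p ≡ p ℕ.+ 1 → IsOptimalSolution p (suc n ℕ.+ p) (narrowForm p)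
  narrow zero    _  = attains⇒optimal 0 1≤p (narrowForm-attains p 1≤p)
  narrow (suc n) eq = ⊥-elim (ℕP.m≢1+n+m p (sym (ℕP.suc-injective (trans eq (ℕP.+-comm p 1)))))
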